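{- Let $k\ge 0$ be an integer and let $C_{4k+3}$ denote the cycle on $4k+3$ vertices. If $G$ is a finite connected graph which satisfies the odd two-pebbling property, then $$f(C_{4k+3}\times G)\leq f(C_{4k+3})\,f(G).$$
   Context: All graphs are finite, simple and connected. A distribution of pebbles on a graph assigns to each vertex a nonnegative integer number of pebbles. A pebbling move removes two pebbles from one vertex and places one pebble on an adjacent vertex. The pebbling number $f(G)$ is the least integer $p$ such that, from every distribution of $p$ pebbles on the vertices of $G$ and for every target vertex $v$ of $G$, it is possible by a (possibly empty) sequence of pebbling moves to place at least one pebble on $v$. A graph $G$ satisfies the odd two-pebbling property if, for every distribution of $p$ pebbles on $G$ in which exactly $r$ vertices carry an odd number of pebbles and $p>2f(G)-r$, and for every vertex $v$ of $G$, it is possible by a sequence of pebbling moves to have at least two pebbles on $v$. The Cartesian product $G\times H$ has vertex set $V(G)\times V(H)$; its edges are the pairs $\{(a,v),(b,v)\}$ with $\{a,b\}\in E(G)$, $v\in V(H)$, and the pairs $\{(u,x),(u,y)\}$ with $u\in V(G)$, $\{x,y\}\in E(H)$. -}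

module Defs where

open import Level using (0ℓ)
open import Data.Empty using (⊥-elim)
open import Data.Nat
open import Data.Nat.Divisibility using (_∣?_)
open import Data.Nat.ListAction using (sum)
open import Data.Nat.Properties
open import Data.Nat.Tactic.RingSolver using (solve-∀)
import Data.Fin as Fin
open Fin using (Fin; toℕ)
import Data.Fin.Properties as Finₚ
open import Data.List using (List; []; _∷_; map; length; filter; allFin; cartesianProduct)
open import Data.List.Membership.Propositional using (_∈_; _∉_; find; lose)
import Data.List.Membership.Propositional.Properties as ∈ₚ
open import Data.List.Relation.Unary.All as All using (All; []; _∷_)
open import Data.List.Relation.Unary.Any as Any using (Any; here; there)
open import Data.List.Relation.Unary.Unique.Propositional using (Unique)
open import Data.List.Relation.Unary.AllPairs using ([]; _∷_)
import Data.List.Relation.Unary.Unique.Propositional.Properties as Uniqueₚ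
open import Data.Product using (∃; ∃-syntax; _×_; _,_; proj₁; proj₂; map₁; map₂)
open import Data.Product.Properties using (≡-dec)
open import Data.Sum as Sum using (_⊎_; inj₁; inj₂; [_,_]′)
open import Function using (_∘_)
open import Relation.Binary.Core using (Rel)
open import Relation.Binary.Definitions
  using (Decidable; DecidableEquality; Symmetric; Irreflexive)
open import Relation.Binary.Construct.Closure.ReflexiveTransitive
  using (Star; ε; _◅_; _◅◅_; gmap; reverse)
open import Relation.Binary.PropositionalEquality
  using (_≡_; _≢_; _≗_; refl; sym; trans; cong; cong₂; subst; subst₂; module ≡-Reasoning)
open import Relation.Nullary
open import Relation.Nullary.Decidable using (map′; _×-dec_; _⊎-dec_; ¬?)

-- Finite simple connected graphs, with at least one vertex.  Finiteness is an
-- explicit duplicate-free enumeration of the vertices; decidability of equality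
-- and adjacency is automatic classically.
record Graph : Set₁ where
  infix 4 _≟ᵥ_ _~_ _~?_
  field
    Vertex    : Set
    _≟ᵥ_      : DecidableEquality Vertex
    vertices  : List Vertex
    unique    : Unique vertices
    complete  : ∀ v → v ∈ vertices
    nonempty  : Vertex
    _~_       : Rel Vertex 0ℓ
    _~?_      : Decidable _~_
    ~-sym     : Symmetric _~_
    ~-irrefl  : Irreflexive _≡_ _~_
    connected : ∀ u v → Star _~_ u v

module Pebbling (G : Graph) where
  open Graph G

  Distribution : Set
  Distribution = Vertex → ℕ

  size : Distribution → ℕ
  size D = sum (map D vertices)

  oddCount : Distribution → ℕ
  oddCount D = length (filter (λ v → ¬? (2 ∣? D v)) vertices)

  infix 4 _⟶_ _⟶*_

  record _⟶_ (D D′ : Distribution) : Set where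
    constructor move
    field
      source target : Vertex
      edge    : source ~ target
      removes : D source ≡ 2 + D′ source
      adds    : D′ target ≡ 1 + D target
      others  : ∀ v → v ≢ source → v ≢ target → D′ v ≡ D v

  _⟶*_ : Rel Distribution 0ℓ
  _⟶*_ = Star _⟶_

  CanPlace : ℕ → Vertex → Distribution → Set
  CanPlace m v D = ∃[ D′ ] (D ⟶* D′ × m ≤ D′ v)

  Suffices : ℕ → Set
  Suffices p = ∀ D → size D ≡ p → ∀ v → CanPlace 1 v D

  IsPebblingNumber : ℕ → Set
  IsPebblingNumber p = Suffices p × (∀ q → Suffices q → p ≤ q)

  ∃? : {P : Vertex → Set} → (∀ v → Dec (P v)) → Dec (∃ P)
  ∃? P? = map′ (λ a → proj₁ (find a) , proj₂ (proj₂ (find a)))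
               (λ (v , p) → lose (complete v) p) (Any.any? P? vertices)

  ∀? : {P : Vertex → Set} → (∀ v → Dec (P v)) → Dec (∀ v → P v)
  ∀? P? = map′ (λ a v → All.lookup a (complete v))
               (λ f → All.tabulate (λ {v} _ → f v)) (All.all? P? vertices)

  δ : Vertex → Vertex → ℕ
  δ u v with v ≟ᵥ u
  ... | yes _ = 1
  ... | no  _ = 0

  δ-∉ : ∀ u xs → u ∉ xs → sum (map (δ u) xs) ≡ 0
  δ-∉ u [] _ = refl
  δ-∉ u (x ∷ xs) u∉ with x ≟ᵥ u
  ... | yes x≡u = ⊥-elim (u∉ (here (sym x≡u)))
  ... | no  _   = δ-∉ u xs (u∉ ∘ there)

  δ-∈ : ∀ u xs → Unique xs → u ∈ xs → sum (map (δ u) xs) ≡ 1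
  δ-∈ u (x ∷ xs) (x∉ ∷ uq) u∈ with x ≟ᵥ u
  ... | yes refl = cong suc (δ-∉ x xs (λ x∈ → All.lookup x∉ x∈ refl))
  ... | no x≢u with u∈
  ...   | here u≡x  = ⊥-elim (x≢u (sym u≡x))
  ...   | there u∈′ = δ-∈ u xs uq u∈′

  sum-swap : ∀ (D D′ : Distribution) u w → (∀ x → D′ x + 2 * δ u x ≡ D x + δ w x) → ∀ xs →
             sum (map D′ xs) + 2 * sum (map (δ u) xs) ≡ sum (map D xs) + sum (map (δ w) xs)
  sum-swap D D′ u w h [] = refl
  sum-swap D D′ u w h (x ∷ xs) =
    trans (rearrange₁ (D′ x) (sum (map D′ xs)) (δ u x) (sum (map (δ u) xs)))
      (trans (cong₂ _+_ (h x) (sum-swap D D′ u w h xs))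
        (rearrange₂ (D x) (δ w x) (sum (map D xs)) (sum (map (δ w) xs))))
    where
    rearrange₁ : ∀ a b c d → a + b + 2 * (c + d) ≡ (a + 2 * c) + (b + 2 * d)
    rearrange₁ = solve-∀
    rearrange₂ : ∀ a b c d → (a + b) + (c + d) ≡ a + c + (b + d)
    rearrange₂ = solve-∀

  size-⟶ : ∀ {D D′} → D ⟶ D′ → size D ≡ 1 + size D′
  size-⟶ {D} {D′} (move u w e r a o) = suc-injective (begin
    suc (size D)                          ≡⟨ +-comm 1 (size D) ⟩
    size D + 1                            ≡⟨ cong (size D +_) (δ-∈ w vertices unique (complete w)) ⟨
    size D + sum (map (δ w) vertices)     ≡⟨ sum-swap D D′ u w pointwise vertices ⟨
    size D′ + 2 * sum (map (δ u) vertices) ≡⟨ cong (λ t → size D′ + 2 * t) (δ-∈ u vertices unique (complete u)) ⟩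
    size D′ + 2                           ≡⟨ +-comm (size D′) 2 ⟩
    2 + size D′                           ∎)
    where
    open ≡-Reasoning
    pointwise : ∀ x → D′ x + 2 * δ u x ≡ D x + δ w x
    pointwise x with x ≟ᵥ u | x ≟ᵥ w
    ... | yes refl | yes refl = ⊥-elim (~-irrefl refl e)
    ... | yes refl | no  _    = trans (+-comm (D′ x) 2) (trans (sym r) (sym (+-identityʳ (D x))))
    ... | no  _    | yes refl = trans (+-identityʳ (D′ x)) (trans a (+-comm 1 (D x)))
    ... | no  x≢u  | no  x≢w  = cong (_+ 0) (o x x≢u x≢w)

  CanPlace-resp : ∀ {m v D E} → D ≗ E → CanPlace m v D → CanPlace m v E
  CanPlace-resp {v = v} {E = E} eq (_ , ε , m≤) = E , ε , subst (_ ≤_) (eq v) m≤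
  CanPlace-resp eq (D″ , move u w e r a o ◅ ms , m≤) =
    D″ , move u w e (trans (sym (eq u)) r) (trans a (cong suc (eq w)))
           (λ v v≢u v≢w → trans (o v v≢u v≢w) (eq v)) ◅ ms , m≤

  fire : Vertex → Vertex → Distribution → Distribution
  fire u w D v with v ≟ᵥ u
  ... | yes _ = D v ∸ 2
  ... | no  _ = δ w v + D v

  fire-⟶ : ∀ {u w D} → u ~ w → 2 ≤ D u → D ⟶ fire u w D
  fire-⟶ {u} {w} {D} e 2≤ = move u w e removes adds others
    where
    removes : D u ≡ 2 + fire u w D u
    removes with u ≟ᵥ u
    ... | yes _   = sym (m+[n∸m]≡n 2≤)
    ... | no  u≢u = ⊥-elim (u≢u refl)
    adds : fire u w D w ≡ 1 + D w
    adds with w ≟ᵥ u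
    ... | yes refl = ⊥-elim (~-irrefl refl e)
    ... | no  _ with w ≟ᵥ w
    ...   | yes _   = refl
    ...   | no  w≢w = ⊥-elim (w≢w refl)
    others : ∀ v → v ≢ u → v ≢ w → fire u w D v ≡ D v
    others v v≢u v≢w with v ≟ᵥ u
    ... | yes v≡u = ⊥-elim (v≢u v≡u)
    ... | no  _ with v ≟ᵥ w
    ...   | yes v≡w = ⊥-elim (v≢w v≡w)
    ...   | no  _   = refl

  fire-unique : ∀ {D D′} (s : D ⟶ D′) →
                D′ ≗ fire (_⟶_.source s) (_⟶_.target s) D
  fire-unique {D} {D′} (move u w e r a o) v with v ≟ᵥ u
  ... | yes refl = cong (_∸ 2) (sym r)
  ... | no  v≢u with v ≟ᵥ w
  ...   | yes refl = a
  ...   | no  v≢w  = o v v≢u v≢w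

  canPlace? : ∀ n m v D → size D < n → Dec (CanPlace m v D)
  canPlace? (suc n) m v D (s≤s D≤n) with m ≤? D v
  ... | yes m≤ = yes (D , ε , m≤)
  ... | no  m≰ = map′ from to (∃? (λ u → ∃? (λ w → step? u w)))
    where
    Step : Vertex → Vertex → Set
    Step u w = (u ~ w × 2 ≤ D u) × CanPlace m v (fire u w D)
    step? : ∀ u w → Dec (Step u w)
    step? u w with (u ~? w) ×-dec (2 ≤? D u)
    ... | no  ¬q = no (¬q ∘ proj₁)
    ... | yes (e , 2≤) = map′ ((e , 2≤) ,_) proj₂
        (canPlace? n m v (fire u w D)
          (≤-trans (≤-reflexive (sym (size-⟶ (fire-⟶ e 2≤)))) D≤n))
    from : (∃[ u ] ∃[ w ] Step u w) → CanPlace m v D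
    from (u , w , (e , 2≤) , D″ , ms , m≤) = D″ , fire-⟶ e 2≤ ◅ ms , m≤
    to : CanPlace m v D → ∃[ u ] ∃[ w ] Step u w
    to (_ , ε , m≤) = ⊥-elim (m≰ m≤)
    to (D″ , s@(move u w e r _ _) ◅ ms , m≤) =
      u , w , (e , subst (2 ≤_) (sym r) (m≤m+n 2 _)) ,
      CanPlace-resp (fire-unique s) (D″ , ms , m≤)

  set : Vertex → ℕ → Distribution → Distribution
  set x c D v with v ≟ᵥ x
  ... | yes _ = c
  ... | no  _ = D v

  bounded? : ∀ p {P : Distribution → Set} →
             (∀ {D E} → D ≗ E → P D → P E) → (∀ D → Dec (P D)) →
             ∀ xs D₀ → Dec (∀ D → (∀ v → v ∉ xs → D v ≡ D₀ v) → (∀ v → D v ≤ p) → P D)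
  bounded? p resp P? [] D₀ with P? D₀
  ... | yes pD₀ = yes (λ D eq _ → resp (λ v → sym (eq v (λ ()))) pD₀)
  ... | no ¬pD₀ with ∀? (λ v → D₀ v ≤? p)
  ...   | yes bd = no (λ f → ¬pD₀ (f D₀ (λ _ _ → refl) bd))
  ...   | no ¬bd = yes (λ D eq bd → ⊥-elim (¬bd (λ v → subst (_≤ p) (eq v (λ ())) (bd v))))
  bounded? p {P} resp P? (x ∷ xs) D₀ =
    map′ from to (allUpTo? (λ c → bounded? p resp P? xs (set x c D₀)) (suc p))
    where
    Q : List Vertex → Distribution → Set
    Q ys E = ∀ D → (∀ v → v ∉ ys → D v ≡ E v) → (∀ v → D v ≤ p) → P D
    from : (∀ {c} → c < suc p → Q xs (set x c D₀)) → Q (x ∷ xs) D₀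
    from f D eq bd = f {D x} (s≤s (bd x)) D agree bd
      where
      agree : ∀ v → v ∉ xs → D v ≡ set x (D x) D₀ v
      agree v v∉ with v ≟ᵥ x
      ... | yes refl = refl
      ... | no  v≢x  = eq v (λ { (here v≡x) → v≢x v≡x ; (there v∈) → v∉ v∈ })
    to : Q (x ∷ xs) D₀ → ∀ {c} → c < suc p → Q xs (set x c D₀)
    to f {c} _ D eq bd = f D agree bd
      where
      agree : ∀ v → v ∉ (x ∷ xs) → D v ≡ D₀ v
      agree v v∉ with v ≟ᵥ x | eq v (v∉ ∘ there)
      ... | yes v≡x | _ = ⊥-elim (v∉ (here v≡x))
      ... | no  _   | q = q

  sum-cong : ∀ {D E : Distribution} → D ≗ E → ∀ xs → sum (map D xs) ≡ sum (map E xs)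
  sum-cong eq []       = refl
  sum-cong eq (x ∷ xs) = cong₂ _+_ (eq x) (sum-cong eq xs)

  term≤sum : ∀ {A : Set} (D : A → ℕ) {v xs} → v ∈ xs → D v ≤ sum (map D xs)
  term≤sum D (here refl) = m≤m+n _ _
  term≤sum D {xs = x ∷ _} (there v∈) = ≤-trans (term≤sum D v∈) (m≤n+m _ (D x))

  suffices? : ∀ p → Dec (Suffices p)
  suffices? p = map′
    (λ f D s v → f D (λ v v∉ → ⊥-elim (v∉ (complete v)))
       (λ v → subst (D v ≤_) s (term≤sum D (complete v))) s v)
    (λ f D _ _ → f D)
    (bounded? p {P} resp P? vertices (λ _ → 0))
    where
    P : Distribution → Set
    P D = size D ≡ p → ∀ v → CanPlace 1 v D
    resp : ∀ {D E} → D ≗ E → P D → P E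
    resp eq pD s v = CanPlace-resp eq (pD (trans (sum-cong eq vertices) s) v)
    P? : ∀ D → Dec (P D)
    P? D with size D ≟ p
    ... | no  ≢p = yes (λ s → ⊥-elim (≢p s))
    ... | yes ≡p = map′ (λ f _ → f) (λ f → f ≡p)
                     (∀? (λ v → canPlace? (suc (size D)) 1 v D ≤-refl))

  pathLength : ∀ {u v} → Star _~_ u v → ℕ
  pathLength ε       = 0
  pathLength (_ ◅ w) = suc (pathLength w)

  transport : ∀ {u w} → u ~ w → ∀ m D → 2 * m ≤ D u →
              ∃[ D′ ] (D ⟶* D′ × m + D w ≤ D′ w)
  transport e zero D _ = D , ε , ≤-refl
  transport {u} {w} e (suc m) D h =
    let h′ = subst (_≤ D u) (double m) h
        s  = fire-⟶ {D = D} e (≤-trans (m≤m+n 2 (2 * m)) h′)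
        D₁ = fire u w D
        D′ , ms , le = transport e m D₁
          (+-cancelˡ-≤ 2 _ _ (subst (2 + 2 * m ≤_) (_⟶_.removes s) h′))
    in D′ , s ◅ ms ,
       subst (_≤ D′ w) (trans (cong (m +_) (_⟶_.adds s)) (+-suc m (D w))) le
    where
    double : ∀ m → 2 * suc m ≡ 2 + 2 * m
    double = solve-∀

  transport* : ∀ {u v} (w : Star _~_ u v) D → 2 ^ pathLength w ≤ D u → CanPlace 1 v D
  transport* ε D h = D , ε , h
  transport* (e ◅ w) D h =
    let D₁ , ms , le = transport e (2 ^ pathLength w) D h
        D₂ , ms′ , le′ = transport* w D₁ (≤-trans (m≤m+n _ _) le)
    in D₂ , ms ◅◅ ms′ , le′

  pigeonhole : ∀ M (D : Distribution) x xs → length (x ∷ xs) * M ≤ sum (map D (x ∷ xs)) →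
               ∃[ v ] M ≤ D v
  pigeonhole M D x xs h with M ≤? D x
  ... | yes M≤ = x , M≤
  pigeonhole M D x [] h | no M≰ =
    x , subst₂ _≤_ (+-identityʳ M) (+-identityʳ (D x)) h
  pigeonhole M D x (y ∷ ys) h | no M≰ =
    pigeonhole M D y ys (+-cancelˡ-≤ M _ _
      (≤-trans h (+-monoˡ-≤ (sum (map D (y ∷ ys))) (<⇒≤ (≰⇒> M≰)))))

  someSuffices : ∃ Suffices
  someSuffices = length vertices * 2 ^ L , suffices
    where
    len : Vertex → Vertex → ℕ
    len u v = pathLength (connected u v)
    L : ℕ
    L = sum (map (λ u → sum (map (len u) vertices)) vertices)
    len≤L : ∀ u v → len u v ≤ L
    len≤L u v = ≤-trans (term≤sum (len u) (complete v))
      (term≤sum (λ u → sum (map (len u) vertices)) (complete u))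
    heavy : ∀ (D : Distribution) xs → nonempty ∈ xs → length xs * 2 ^ L ≤ sum (map D xs) →
            ∃[ u ] 2 ^ L ≤ D u
    heavy D (x ∷ xs) _ = pigeonhole (2 ^ L) D x xs
    suffices : Suffices (length vertices * 2 ^ L)
    suffices D s v =
      let u , h = heavy D vertices (complete nonempty) (≤-reflexive (sym s))
      in transport* (connected u v) D (≤-trans (^-monoʳ-≤ 2 (len≤L u v)) h)

  leastFrom : ∀ {P : ℕ → Set} → (∀ n → Dec (P n)) → ∀ d a → (∀ q → P q → a ≤ q) →
              P (d + a) → ∃[ p ] (P p × (∀ q → P q → p ≤ q))
  leastFrom P? zero a lb pa = a , pa , lb
  leastFrom {P} P? (suc d) a lb pda with P? a
  ... | yes pa = a , pa , lb
  ... | no ¬pa = leastFrom P? d (suc a)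
      (λ q pq → ≤∧≢⇒< (lb q pq) (λ { refl → ¬pa pq }))
      (subst P (sym (+-suc d a)) pda)

  abstract
    pebblingNumber : ∃ IsPebblingNumber
    pebblingNumber = leastFrom suffices? (proj₁ someSuffices) 0 (λ _ _ → z≤n)
      (subst Suffices (sym (+-identityʳ _)) (proj₂ someSuffices))

open Pebbling using (IsPebblingNumber)

f : Graph → ℕ
f G = proj₁ (Pebbling.pebblingNumber G)

f-isPebblingNumber : ∀ G → IsPebblingNumber G (f G)
f-isPebblingNumber G = proj₂ (Pebbling.pebblingNumber G)

-- The inequality p > 2 f(G) - r is written additively to avoid truncated
-- subtraction.
OddTwoPebbling : Graph → Set
OddTwoPebbling G = ∀ (D : Distribution) (p r : ℕ) → size D ≡ p → oddCount D ≡ r →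
                   p + r > 2 * f G → ∀ v → CanPlace 2 v D
  where open Pebbling G

infixr 7 _□_

_□_ : Graph → Graph → Graph
G □ H = record
  { Vertex    = G.Vertex × H.Vertex
  ; _≟ᵥ_      = ≡-dec G._≟ᵥ_ H._≟ᵥ_
  ; vertices  = cartesianProduct G.vertices H.vertices
  ; unique    = Uniqueₚ.cartesianProduct⁺ G.unique H.unique
  ; complete  = λ (u , x) → ∈ₚ.∈-cartesianProduct⁺ (G.complete u) (H.complete x)
  ; nonempty  = G.nonempty , H.nonempty
  ; _~_       = λ (u , x) (v , y) → (u G.~ v × x ≡ y) ⊎ (u ≡ v × x H.~ y)
  ; _~?_      = λ (u , x) (v , y) →
                  ((u G.~? v) ×-dec (x H.≟ᵥ y)) ⊎-dec ((u G.≟ᵥ v) ×-dec (x H.~? y))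
  ; ~-sym     = Sum.map (map₁ G.~-sym ∘ map₂ sym) (map₁ sym ∘ map₂ H.~-sym)
  ; ~-irrefl  = λ { refl → [ G.~-irrefl refl ∘ proj₁ , H.~-irrefl refl ∘ proj₂ ]′ }
  ; connected = λ (u , x) (v , y) →
                  gmap (_, x) (λ e → inj₁ (e , refl)) (G.connected u v) ◅◅
                  gmap (v ,_) (λ e → inj₂ (refl , e)) (H.connected x y)
  }
  where
  module G = Graph G
  module H = Graph H

CyclicSuc : ∀ {n} → Rel (Fin n) 0ℓ
CyclicSuc {n} i j = toℕ j ≡ suc (toℕ i) ⊎ (suc (toℕ i) ≡ n × toℕ j ≡ 0)

CyclicAdj : ∀ {n} → Rel (Fin n) 0ℓ
CyclicAdj i j = CyclicSuc i j ⊎ CyclicSuc j i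

private
  cyclicSuc? : ∀ {n} → Decidable (CyclicSuc {n})
  cyclicSuc? {n} i j = (toℕ j ≟ suc (toℕ i)) ⊎-dec ((suc (toℕ i) ≟ n) ×-dec (toℕ j ≟ 0))

  ¬cyclicSuc : ∀ {n} → 3 ≤ n → (i : Fin n) → ¬ CyclicSuc i i
  ¬cyclicSuc 3≤n i (inj₁ i≡1+i) = m≢1+m+n (toℕ i) (trans i≡1+i (sym (cong suc (+-identityʳ _))))
  ¬cyclicSuc {n} 3≤n i (inj₂ (1+i≡n , i≡0))
    with s≤s () ← subst (3 ≤_) (trans (sym 1+i≡n) (cong suc i≡0)) 3≤n

  fromZero : ∀ {n} (i : Fin (suc n)) → Star CyclicAdj Fin.zero i
  fromZero {n} i = subst (Star CyclicAdj Fin.zero) (Finₚ.fromℕ<-toℕ i (Finₚ.toℕ<n i)) (go (toℕ i) (Finₚ.toℕ<n i))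
    where
    go : ∀ m (m< : m < suc n) → Star CyclicAdj Fin.zero (Fin.fromℕ< m<)
    go zero    (s≤s _) = ε
    go (suc m) m< = go m (<-trans (n<1+n m) m<) ◅◅
      (inj₁ (inj₁ (trans (Finₚ.toℕ-fromℕ< m<) (cong suc (sym (Finₚ.toℕ-fromℕ< _))))) ◅ ε)

  cyclic-connected : ∀ {n} (i j : Fin n) → Star CyclicAdj i j
  cyclic-connected {suc n} i j = reverse Sum.swap (fromZero i) ◅◅ fromZero j

cycle : ∀ n → 3 ≤ n → Graph
cycle n 3≤n = record
  { Vertex    = Fin n
  ; _≟ᵥ_      = Finₚ._≟_
  ; vertices  = allFin n
  ; unique    = Uniqueₚ.allFin⁺ n
  ; complete  = ∈ₚ.∈-allFin
  ; nonempty  = Fin.fromℕ< (≤-trans (s≤s z≤n) 3≤n)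
  ; _~_       = CyclicAdj
  ; _~?_      = λ i j → cyclicSuc? i j ⊎-dec cyclicSuc? j i
  ; ~-sym     = Sum.swap
  ; ~-irrefl  = λ { {i} refl → [ ¬cyclicSuc 3≤n i , ¬cyclicSuc 3≤n i ]′ }
  ; connected = cyclic-connected
  }

module Submission where

-- Write N = f(G), ⌊D/2⌋ and ⌈D/2⌉ for the pointwise halves of a distribution,
-- and lo, hi for their sizes.  The odd two-pebbling property says that hi D > N
-- puts two pebbles on v; keeping the odd vertices, hi D > lN even gives 2l pebbles
-- on v plus pairs worth hi D - lN - 1 pebbles on any adjacent copy of G.  On the
-- other hand a copy can always send lo D pebbles to an adjacent copy.
--
-- For n = 4k + 3 put 4^k = 3b + 1; then f(C) ≥ 8b + 3.  From the target copy two
-- paths x and y of 2k + 1 further copies lead to the adjacent antipodal copies P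
-- and Q.  If hi Q plus the number of pebbles on the rest of y is at most
-- (2b + 1)N, then sending lo Q across to P leaves 2(3b + 1)N pebbles on x and the
-- target, which is enough.  Otherwise, if P can provide b pebbles on the copy of v
-- before Q and Q can provide one more, these and the pebbles of y suffice.  The two
-- cases meet exactly, since (8b + 3) - (2b + 1) = 2(3b + 1).  When P or Q is too
-- small for this, there are so many pebbles elsewhere that losing one pebble per
-- odd vertex does no harm.

open import Data.Empty using (⊥-elim)
open import Data.Fin using (Fin; toℕ; fromℕ<)
open import Data.Fin.Properties as Finₚ using (toℕ-fromℕ<; toℕ<n; toℕ-injective)
open import Data.List using (List; []; _∷_; _++_; map; length; filter; cartesianProduct)
open import Data.List.Properties using (filter-accept; filter-reject; map-++; map-∘)
open import Data.Nat
open import Data.Nat.Divisibility using (_∣_; _∣?_; divides)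
open import Data.Nat.DivMod
  using (_mod_; m%n<n; n%n≡0; m<n⇒m%n≡m; [m+n]%n≡m%n; [m+kn]%n≡m%n; m≡m%n+[m/n]*n)
open import Data.Nat.ListAction using (sum)
open import Data.Nat.ListAction.Properties using (sum-++)
open import Data.Nat.Properties
open import Data.Nat.Tactic.RingSolver using (solve-∀)
open import Data.Product using (∃-syntax; _×_; _,_; proj₁; proj₂)
open import Data.Sum using (_⊎_; inj₁; inj₂; [_,_]′)
open import Function using (_∘_)
open import Relation.Binary.Construct.Closure.ReflexiveTransitive using (ε; _◅_; _◅◅_; gmap)
open import Relation.Binary.PropositionalEquality
open import Relation.Nullary
open import Relation.Nullary.Decidable using (¬?)
open import Defs

-- Arithmetic and finite sums.

-- A linear consequence l ≤ r of hypotheses whose sum is s ≤ t reduces to a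
-- semiring identity, with slack e.
linear : ∀ {l r s t} e → s ≤ t → l + t + e ≡ r + s → l ≤ r
linear {l} {r} {s} {t} e s≤t eq = +-cancelʳ-≤ t l r (begin
  l + t     ≤⟨ m≤m+n _ e ⟩
  l + t + e ≡⟨ eq ⟩
  r + s     ≤⟨ +-monoʳ-≤ r s≤t ⟩
  r + t     ∎)
  where open ≤-Reasoning

sum-map-+ : ∀ {A : Set} (g h : A → ℕ) xs →
            sum (map (λ x → g x + h x) xs) ≡ sum (map g xs) + sum (map h xs)
sum-map-+ g h []       = refl
sum-map-+ g h (x ∷ xs) = trans (cong (g x + h x +_) (sum-map-+ g h xs))
                               (interchange (g x) (h x) (sum (map g xs)) (sum (map h xs)))
  where
  interchange : ∀ a b c d → a + b + (c + d) ≡ a + c + (b + d)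
  interchange = solve-∀

sum-map-≤ : ∀ {A : Set} {g h : A → ℕ} → (∀ x → g x ≤ h x) → ∀ xs →
            sum (map g xs) ≤ sum (map h xs)
sum-map-≤ g≤h []       = z≤n
sum-map-≤ g≤h (x ∷ xs) = +-mono-≤ (g≤h x) (sum-map-≤ g≤h xs)

sum-map-1 : ∀ {A : Set} (xs : List A) → sum (map (λ _ → 1) xs) ≡ length xs
sum-map-1 []       = refl
sum-map-1 (_ ∷ xs) = cong suc (sum-map-1 xs)

sum-map-* : ∀ {A : Set} c (g : A → ℕ) xs → sum (map (λ x → c * g x) xs) ≡ c * sum (map g xs)
sum-map-* c g []       = sym (*-zeroʳ c)
sum-map-* c g (x ∷ xs) = trans (cong (c * g x +_) (sum-map-* c g xs)) (sym (*-distribˡ-+ c (g x) _))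

positive-term : ∀ {A : Set} (g : A → ℕ) xs → 0 < sum (map g xs) → ∃[ x ] 0 < g x
positive-term g (x ∷ xs) 0< with g x in eq
... | zero  = positive-term g xs 0<
... | suc _ = x , subst (0 <_) (sym eq) z<s

-- Reachability up to surplus pebbles, in an arbitrary graph.

module Reach (H : Graph) where
  open Graph H
  open Pebbling H

  infixl 6 _⊕_ _⊖_
  infix 7 _•_
  infix 4 _≼_ _⇒_

  _⊕_ _⊖_ : Distribution → Distribution → Distribution
  (D ⊕ E) v = D v + E v
  (D ⊖ E) v = D v ∸ E v

  _•_ : ℕ → Vertex → Distribution
  (n • u) v = n * δ u v

  lower upper : Distribution → Distribution
  lower D v = ⌊ D v /2⌋
  upper D v = ⌈ D v /2⌉

  lo hi : Distribution → ℕ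
  lo D = size (lower D)
  hi D = size (upper D)

  _≼_ : Distribution → Distribution → Set
  D ≼ E = ∀ v → D v ≤ E v

  -- Only domination of `E` by a reached distribution is required. Surplus pebbles can thus be
  -- forgotten at any time, and no equality of functions is ever needed.
  record _⇒_ (D E : Distribution) : Set where
    constructor reach
    field
      {result} : Distribution
      steps    : D ⟶* result
      bound    : E ≼ result

  weaken : ∀ {D E} → E ≼ D → D ⇒ E
  weaken E≼D = reach ε E≼D

  keep : ∀ D → D ⇒ D
  keep D = weaken (λ _ → ≤-refl)

  ≗⇒ : ∀ {D E} → (∀ v → D v ≡ E v) → D ⇒ E
  ≗⇒ eq = weaken (λ v → ≤-reflexive (sym (eq v)))

  -- The surplus `E ⊖ D` is untouched by the move and is added back afterwards. This is what makes
  -- `_⇒_` transitive.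
  mono-⟶ : ∀ {D D′ E} → D ≼ E → D ⟶ D′ → ∃[ E′ ] (E ⟶ E′ × D′ ≼ E′)
  mono-⟶ {D} {D′} {E} D≼E (move u w e r a o) =
    D′ ⊕ (E ⊖ D) ,
    move u w e
      (trans (split u) (cong (_+ (E u ∸ D u)) r))
      (trans (cong (_+ (E w ∸ D w)) a) (cong suc (sym (split w))))
      (λ v v≢u v≢w → trans (cong (_+ (E v ∸ D v)) (o v v≢u v≢w)) (sym (split v))) ,
    λ v → m≤m+n _ _
    where
    split : ∀ v → E v ≡ D v + (E v ∸ D v)
    split v = sym (m+[n∸m]≡n (D≼E v))

  mono-⟶* : ∀ {D D′ E} → D ≼ E → D ⟶* D′ → E ⇒ D′
  mono-⟶* D≼E ε = weaken D≼E
  mono-⟶* D≼E (s ◅ ss) with mono-⟶ D≼E s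
  ... | _ , s′ , D₁≼E₁ with mono-⟶* D₁≼E₁ ss
  ...   | reach ss′ D′≼ = reach (s′ ◅ ss′) D′≼

  infixr 5 _⨾_

  _⨾_ : ∀ {D E F} → D ⇒ E → E ⇒ F → D ⇒ F
  reach ss E≼ ⨾ reach ss′ F≼ with mono-⟶* E≼ ss′
  ... | reach ss″ E′≼ = reach (ss ◅◅ ss″) (λ v → ≤-trans (F≼ v) (E′≼ v))

  frame-⟶ : ∀ {D D′} F → D ⟶ D′ → D ⊕ F ⟶ D′ ⊕ F
  frame-⟶ F (move u w e r a o) =
    move u w e (cong (_+ F u) r) (cong (_+ F w) a)
         (λ v v≢u v≢w → cong (_+ F v) (o v v≢u v≢w))

  ⊕-congˡ : ∀ {D E} F → D ⇒ E → D ⊕ F ⇒ E ⊕ F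
  ⊕-congˡ F (reach ss E≼) = reach (gmap (_⊕ F) (frame-⟶ F) ss) (λ v → +-monoˡ-≤ (F v) (E≼ v))

  ⊕-comm : ∀ D E → D ⊕ E ⇒ E ⊕ D
  ⊕-comm D E = ≗⇒ (λ v → +-comm (D v) (E v))

  ⊕-cong : ∀ {D D′ E E′} → D ⇒ D′ → E ⇒ E′ → D ⊕ E ⇒ D′ ⊕ E′
  ⊕-cong {D} {D′} {E} {E′} p q = ⊕-congˡ E p ⨾ ⊕-comm D′ E ⨾ ⊕-congˡ D′ q ⨾ ⊕-comm E′ D′

  δ-self : ∀ u → δ u u ≡ 1
  δ-self u with u ≟ᵥ u
  ... | yes _   = refl
  ... | no  u≢u = ⊥-elim (u≢u refl)

  size-δ : ∀ u → size (δ u) ≡ 1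
  size-δ u = δ-∈ u vertices unique (complete u)

  size-⊕ : ∀ D E → size (D ⊕ E) ≡ size D + size E
  size-⊕ D E = sum-map-+ D E vertices

  size-≗ : ∀ {D E} → (∀ v → D v ≡ E v) → size D ≡ size E
  size-≗ eq = sum-cong eq vertices

  size-⊖ : ∀ {D E} → E ≼ D → size E + size (D ⊖ E) ≡ size D
  size-⊖ {D} {E} E≼D = trans (sym (size-⊕ E (D ⊖ E))) (size-≗ (λ v → m+[n∸m]≡n (E≼D v)))

  lo+hi : ∀ D → lo D + hi D ≡ size D
  lo+hi D = trans (sym (size-⊕ (lower D) (upper D))) (size-≗ (λ v → ⌊n/2⌋+⌈n/2⌉≡n (D v)))

  hi≤size : ∀ D → hi D ≤ size D
  hi≤size D = ≤-trans (m≤n+m (hi D) (lo D)) (≤-reflexive (lo+hi D))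

  extract : ∀ D {n} → size D ≡ suc n →
            ∃[ u ] ∃[ E ] ((∀ v → D v ≡ δ u v + E v) × size E ≡ n)
  extract D {n} eq =
    let u , 0<Du = positive-term D vertices (subst (0 <_) (sym eq) z<s)
        δ≼D : δ u ≼ D
        δ≼D = λ v → δ≤ u v 0<Du
    in u , D ⊖ δ u , (λ v → sym (m+[n∸m]≡n (δ≼D v))) ,
       suc-injective (trans (trans (cong (_+ size (D ⊖ δ u)) (sym (size-δ u))) (size-⊖ δ≼D)) eq)
    where
    δ≤ : ∀ u v → 0 < D u → δ u v ≤ D v
    δ≤ u v 0<Du with v ≟ᵥ u
    ... | yes refl = 0<Du
    ... | no  _    = z≤n

  -- `Suffices p` speaks of exactly `p` pebbles, so larger distributions have to be cut down before
  -- it applies.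
  subdistribution : ∀ n D → n ≤ size D → ∃[ E ] (E ≼ D × size E ≡ n)
  subdistribution n D n≤ = go (size D ∸ n) D (sym (m∸n+n≡m n≤))
    where
    go : ∀ k D → size D ≡ k + n → ∃[ E ] (E ≼ D × size E ≡ n)
    go zero    D eq = D , (λ _ → ≤-refl) , eq
    go (suc k) D eq with extract D eq
    ... | u , D₁ , D≗ , eq₁ with go k D₁ eq₁
    ...   | E , E≼D₁ , eqE = E , (λ v → ≤-trans (E≼D₁ v) (subst (D₁ v ≤_) (sym (D≗ v)) (m≤n+m _ _))) , eqE

  canPlace⇒ : ∀ {m v D} → CanPlace m v D → D ⇒ m • v
  canPlace⇒ {m} {v} (D′ , ss , m≤) = reach ss bound
    where
    bound : m • v ≼ D′
    bound u with u ≟ᵥ v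
    ... | yes refl = subst (_≤ D′ v) (sym (*-identityʳ m)) m≤
    ... | no  _    = subst (_≤ D′ u) (sym (*-zeroʳ m)) z≤n

  •-+ : ∀ m n v → m • v ⊕ n • v ⇒ (m + n) • v
  •-+ m n v = ≗⇒ (λ u → sym (*-distribʳ-+ (δ v u) m n))

-- Halving distributions on a single copy of `G`.

module Copies (G : Graph) where
  open Graph G
  open Pebbling G
  open Reach G

  N : ℕ
  N = f G

  -- With one pebble on every vertex except the target no move is possible and the target stays
  -- empty. The same holds for every part of that distribution, so fewer pebbles than vertices never
  -- suffice.
  order≤N : length vertices ≤ N
  order≤N with length vertices ≤? N
  ... | yes p = p
  ... | no ¬p = ⊥-elim (1≰0 (stuck ss 1≤))
    where
    D₀ : Distribution
    D₀ = (λ _ → 1) ⊖ δ nonempty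
    δ≤1 : δ nonempty ≼ (λ _ → 1)
    δ≤1 v with v ≟ᵥ nonempty
    ... | yes _ = ≤-refl
    ... | no  _ = z≤n
    size-D₀ : 1 + size D₀ ≡ length vertices
    size-D₀ = trans (cong (_+ size D₀) (sym (size-δ nonempty)))
                    (trans (size-⊖ δ≤1) (sum-map-1 vertices))
    sub = subdistribution N D₀ (s≤s⁻¹ (subst (N <_) (sym size-D₀) (≰⇒> ¬p)))
    E = proj₁ sub
    placed = proj₁ (f-isPebblingNumber G) E (proj₂ (proj₂ sub)) nonempty
    ss = proj₁ (proj₂ placed)
    1≤ = proj₂ (proj₂ placed)
    1≰0 : ¬ (1 ≤ 0)
    1≰0 ()
    stuck : ∀ {F} → E ⟶* F → 1 ≤ F nonempty → 1 ≤ 0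
    stuck ε 1≤E = subst (1 ≤_) (cong (1 ∸_) (δ-self nonempty)) (≤-trans 1≤E (proj₁ (proj₂ sub) nonempty))
    stuck (move u w e r a o ◅ _) _ with subst (_≤ 1) r (≤-trans (proj₁ (proj₂ sub) u) (m∸n≤m 1 (δ nonempty u)))
    ... | s≤s ()

  -- `hi D` exceeds `lo D` by one for each odd vertex, and there are at most `N` vertices.
  hi≤lo+N : ∀ D → hi D ≤ lo D + N
  hi≤lo+N D = begin
    hi D                              ≤⟨ sum-map-≤ (λ v → ceil≤ (D v)) vertices ⟩
    size (lower D ⊕ (λ _ → 1))        ≡⟨ size-⊕ (lower D) (λ _ → 1) ⟩
    lo D + size (λ _ → 1)             ≡⟨ cong (lo D +_) (sum-map-1 vertices) ⟩
    lo D + length vertices            ≤⟨ +-monoʳ-≤ (lo D) order≤N ⟩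
    lo D + N                          ∎
    where
    open ≤-Reasoning
    ceil≤ : ∀ n → ⌈ n /2⌉ ≤ ⌊ n /2⌋ + 1
    ceil≤ zero = z≤n
    ceil≤ (suc zero) = ≤-refl
    ceil≤ (suc (suc n)) = s≤s (ceil≤ n)

  place-one : ∀ {D} v → N ≤ size D → D ⇒ 1 • v
  place-one v N≤ with subdistribution N _ N≤
  ... | E , E≼D , eq = weaken E≼D ⨾ canPlace⇒ (proj₁ (f-isPebblingNumber G) E eq v)

  -- Each odd vertex is rounded up by one half. The hypothesis of the odd two-pebbling property thus
  -- becomes `N < hi D`, the form used from here on.
  size+oddCount : ∀ D → size D + oddCount D ≡ 2 * hi D
  size+oddCount D = go vertices
    where
    double-suc : ∀ h → 2 + 2 * h ≡ 2 * (1 + h)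
    double-suc = solve-∀
    even : ∀ q → q * 2 ≡ 2 * ⌈ q * 2 /2⌉
    even zero    = refl
    even (suc q) = trans (cong (2 +_) (even q)) (double-suc ⌈ q * 2 /2⌉)
    odd : ∀ n → ¬ 2 ∣ n → n + 1 ≡ 2 * ⌈ n /2⌉
    odd zero          ¬2∣ = ⊥-elim (¬2∣ (divides 0 refl))
    odd (suc zero)    ¬2∣ = refl
    odd (suc (suc n)) ¬2∣ =
      trans (cong (2 +_) (odd n (λ { (divides q eq) → ¬2∣ (divides (suc q) (cong (2 +_) eq)) })))
            (double-suc ⌈ n /2⌉)
    regroup₀ : ∀ n s r h h′ → n ≡ 2 * h → s + r ≡ 2 * h′ → n + s + r ≡ 2 * (h + h′)
    regroup₀ n s r h h′ p q = trans (+-assoc n s r) (trans (cong₂ _+_ p q) (sym (*-distribˡ-+ 2 h h′)))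
    regroup₁ : ∀ n s r h h′ → n + 1 ≡ 2 * h → s + r ≡ 2 * h′ → n + s + suc r ≡ 2 * (h + h′)
    regroup₁ n s r h h′ p q = trans (move-one n s r) (trans (cong₂ _+_ p q) (sym (*-distribˡ-+ 2 h h′)))
      where
      move-one : ∀ n s r → n + s + suc r ≡ (n + 1) + (s + r)
      move-one = solve-∀
    go : ∀ xs → sum (map D xs) + length (filter (λ v → ¬? (2 ∣? D v)) xs) ≡ 2 * sum (map (upper D) xs)
    go [] = refl
    go (x ∷ xs) = cons (2 ∣? D x)
      where
      isOdd? = λ v → ¬? (2 ∣? D v)
      S = sum (map D xs)
      R = length (filter isOdd? xs)
      U = sum (map (upper D) xs)
      cons : Dec (2 ∣ D x) → sum (map D (x ∷ xs)) + length (filter isOdd? (x ∷ xs)) ≡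
             2 * sum (map (upper D) (x ∷ xs))
      cons (yes 2∣@(divides q eq)) = trans
        (cong (λ ys → D x + S + length ys) (filter-reject isOdd? (λ ¬2∣ → ¬2∣ 2∣)))
        (regroup₀ (D x) S R ⌈ D x /2⌉ U (subst (λ n → n ≡ 2 * ⌈ n /2⌉) (sym eq) (even q)) (go xs))
      cons (no ¬2∣) = trans
        (cong (λ ys → D x + S + length ys) (filter-accept isOdd? ¬2∣))
        (regroup₁ (D x) S R ⌈ D x /2⌉ U (odd (D x) ¬2∣) (go xs))

  place-many : ∀ l {D} v → l * N ≤ size D → D ⇒ l • v
  place-many zero    v _ = weaken (λ _ → z≤n)
  place-many (suc l) {D} v l≤ with subdistribution N D (m+n≤o⇒m≤o N l≤)
  ... | E , E≼D , eq =
    ≗⇒ (λ u → sym (m+[n∸m]≡n (E≼D u))) ⨾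
    ⊕-cong (place-one v (≤-reflexive (sym eq))) (place-many l v rest) ⨾ •-+ 1 l v
    where
    rest : l * N ≤ size (D ⊖ E)
    rest = +-cancelˡ-≤ N _ _ (≤-trans l≤ (≤-reflexive
      (trans (sym (size-⊖ E≼D)) (cong (_+ size (D ⊖ E)) eq))))

  -- Removing pairs from D lowers ⌊D/2⌋ and ⌈D/2⌉ alike, so the odd vertices survive.
  remove-pairs : ∀ n D → n ≤ lo D →
                 ∃[ E ] ∃[ F ] (D ⇒ E ⊕ (F ⊕ F) × hi D ≡ hi E + n × size F ≡ n)
  remove-pairs n D n≤ with subdistribution n (lower D) n≤
  ... | F , F≼ , eq =
    D ⊖ (F ⊕ F) , F , ≗⇒ (λ v → sym (m∸n+n≡m (2F≤ v))) ,
    trans (trans (size-≗ (λ v → upper-∸ (F v) (D v) (F≼ v))) (size-⊕ (upper (D ⊖ (F ⊕ F))) F))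
          (cong (hi (D ⊖ (F ⊕ F)) +_) eq) ,
    eq
    where
    2F≤ : F ⊕ F ≼ D
    2F≤ v = ≤-trans (+-mono-≤ (F≼ v) (≤-trans (F≼ v) (⌊n/2⌋≤⌈n/2⌉ (D v)))) (≤-reflexive (⌊n/2⌋+⌈n/2⌉≡n (D v)))
    upper-∸ : ∀ x d → x ≤ ⌊ d /2⌋ → ⌈ d /2⌉ ≡ ⌈ d ∸ (x + x) /2⌉ + x
    upper-∸ zero d _ = sym (+-identityʳ _)
    upper-∸ (suc x) (suc (suc d)) (s≤s x≤) rewrite +-suc x x =
      trans (cong suc (upper-∸ x d x≤)) (sym (+-suc _ x))

-- Consequences of the odd two-pebbling property.

module OddCopies (G : Graph) (odd₂ : OddTwoPebbling G) where
  open Graph G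
  open Pebbling G
  open Reach G
  open Copies G public

  place-two : ∀ {D} v → N < hi D → D ⇒ 2 • v
  place-two {D} v N< = canPlace⇒ (odd₂ D _ _ refl refl
    (subst (2 * N <_) (sym (size+oddCount D)) (*-monoʳ-< 2 N<)) v)

  -- While `l` exceeds 1, `N` pairs are split off, which exist by `hi≤lo+N`. Each of their two
  -- halves places one pebble on `v`, and `hi` falls only by `N`. The odd two-pebbling property is
  -- spent once, at the end.
  place-even : ∀ l {D} v → 0 < l → l * N < hi D → D ⇒ (2 * l) • v
  place-even (suc zero) {D} v _ N< = place-two v (subst (_< hi D) (+-identityʳ N) N<)
  place-even (suc (suc l)) {D} v _ l< =
    let E , F , D⇒ , hiD≡ , sizeF≡ = remove-pairs N D (N≤lo (hi D) (lo D) l< (hi≤lo+N D))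
        one = place-one {F} v (≤-reflexive (sym sizeF≡))
    in D⇒ ⨾ ⊕-cong (place-even (suc l) v z<s (rest (hi D) (hi E) hiD≡ l<)) (⊕-cong one one) ⨾
       ≗⇒ (λ u → eq l (δ v u))
    where
    N≤lo : ∀ h l′ → suc (suc l) * N < h → h ≤ l′ + N → N ≤ l′
    N≤lo h l′ p q = linear (suc (l * N)) (+-mono-≤ p q) (identity N (l * N) h l′)
      where
      identity : ∀ n m h l → n + (h + (l + n)) + suc m ≡ l + (suc (n + (n + m)) + h)
      identity = solve-∀
    rest : ∀ h h′ → h ≡ h′ + N → suc (suc l) * N < h → suc l * N < h′
    rest h h′ refl p = +-cancelʳ-< N _ _ (subst (_< h) (+-comm N (suc l * N)) p)
    eq : ∀ l d → 2 * suc l * d + (1 * d + 1 * d) ≡ 2 * suc (suc l) * d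
    eq = solve-∀

  -- The odd vertices are kept together with just enough pairs for the odd
  -- two-pebbling property; all other pebbles come in pairs.
  place-even-with-pairs : ∀ l D v → 0 < l → l * N < hi D →
    ∃[ F ] (D ⇒ (2 * l) • v ⊕ (F ⊕ F) × suc (l * N) + size F ≡ hi D)
  place-even-with-pairs l@(suc l-1) D v _ l< =
    let E , F , D⇒ , hiD≡ , sizeF≡ = remove-pairs (hi D ∸ used) D excess≤lo
        used+ = m+[n∸m]≡n l<
    in F ,
       D⇒ ⨾ ⊕-congˡ (F ⊕ F)
         (place-even l v z<s (≤-reflexive (sym (+-cancelʳ-≡ (hi D ∸ used) (hi E) used (trans (sym hiD≡) (sym used+)))))) ,
       trans (cong (used +_) sizeF≡) used+
    where
    used = suc (l * N)
    excess≤lo : hi D ∸ used ≤ lo D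
    excess≤lo = ≤-trans (∸-monoʳ-≤ (hi D) (≤-trans (m≤m+n N (l-1 * N)) (n≤1+n _)))
                        (m≤n+o⇒m∸n≤o (hi D) N (≤-trans (hi≤lo+N D) (≤-reflexive (+-comm (lo D) N))))

even⊎odd : ∀ j → ∃[ h ] (j ≡ 2 * h ⊎ j ≡ suc (2 * h))
even⊎odd zero          = 0 , inj₁ refl
even⊎odd (suc zero)    = 0 , inj₂ refl
even⊎odd (suc (suc j)) with even⊎odd j
... | h , inj₁ eq = suc h , inj₁ (cong suc (trans (cong suc eq) (sym (+-suc h (h + 0)))))
... | h , inj₂ eq = suc h , inj₂ (cong (2 +_) (trans eq (sym (+-suc h (h + 0)))))

-- Moving pebbles between copies of `G` in the product.

module Product (C G : Graph) (odd₂ : OddTwoPebbling G) where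
  private
    module C = Graph C
    module G = Graph G
  open Pebbling G using (Distribution; size; δ)
  open Pebbling (C □ G) using (fire; fire-⟶) renaming (Distribution to Distribution□; _⟶_ to _⟶□_; move to move□)
  open Reach G using (lower; lo; hi; lo+hi; hi≤size; extract; size-⊖; subdistribution)
    renaming (_⊕_ to _+ᵈ_; _⊖_ to _-ᵈ_; _•_ to _•ᴳ_; _≼_ to _≼ᴳ_; _⇒_ to _⇒ᴳ_; _⨾_ to _⨾ᴳ_;
              weaken to weakenᴳ; keep to keepᴳ; ≗⇒ to ≗⇒ᴳ; ⊕-cong to +ᵈ-cong; ⊕-congˡ to +ᵈ-congˡ;
              size-⊕ to size-+ᵈ; •-+ to •ᴳ-+)
  open Reach (C □ G) using (_⊕_; _≼_; _⇒_; reach; weaken; keep; ≗⇒; _⨾_; ⊕-cong)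
  open OddCopies G odd₂

  place : C.Vertex → Distribution → Distribution□
  place c D (c′ , g) with c′ C.≟ᵥ c
  ... | yes _ = D g
  ... | no  _ = 0

  place-self : ∀ c D g → place c D (c , g) ≡ D g
  place-self c D g with c C.≟ᵥ c
  ... | yes _   = refl
  ... | no  c≢c = ⊥-elim (c≢c refl)

  place-⊕ : ∀ c D E v → place c (D +ᵈ E) v ≡ (place c D ⊕ place c E) v
  place-⊕ c D E (c′ , g) with c′ C.≟ᵥ c
  ... | yes _ = refl
  ... | no  _ = refl

  place-mono : ∀ c {D E} → E ≼ᴳ D → place c E ≼ place c D
  place-mono c E≼D (c′ , g) with c′ C.≟ᵥ c
  ... | yes _ = E≼D g
  ... | no  _ = z≤n

  split : ∀ c D E → place c (D +ᵈ E) ⇒ place c D ⊕ place c E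
  split c D E = ≗⇒ (place-⊕ c D E)

  join : ∀ c D E → place c D ⊕ place c E ⇒ place c (D +ᵈ E)
  join c D E = ≗⇒ (λ v → sym (place-⊕ c D E v))

  lift : ∀ c {D E} → D ⇒ᴳ E → place c D ⇒ place c E
  lift c (Reach.reach ss E≼) = reach (gmap (place c) step ss) (place-mono c E≼)
    where
    step : ∀ {D D′} → Pebbling._⟶_ G D D′ → place c D ⟶□ place c D′
    step {D} {D′} (Pebbling.move u w e r a o) =
      move□ (c , u) (c , w) (inj₂ (refl , e))
        (trans (place-self c D u) (trans r (cong (2 +_) (sym (place-self c D′ u)))))
        (trans (place-self c D′ w) (trans a (cong suc (sym (place-self c D w)))))
        others
      where
      others : ∀ v → v ≢ (c , u) → v ≢ (c , w) → place c D′ v ≡ place c D v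
      others (c′ , g) v≢u v≢w with c′ C.≟ᵥ c
      ... | yes refl = o g (λ { refl → v≢u refl }) (λ { refl → v≢w refl })
      ... | no  _    = refl

  move-one : ∀ {c c′} → c C.~ c′ → ∀ u → place c (δ u +ᵈ δ u) ⇒ place c′ (δ u)
  move-one {c} {c′} e u = reach (fire-⟶ {(c , u)} {(c′ , u)} (inj₁ (e , refl)) two ◅ ε) bound
    where
    D = place c (δ u +ᵈ δ u)
    s = fire-⟶ {(c , u)} {(c′ , u)} {D} (inj₁ (e , refl))
    at-u : D (c , u) ≡ 2
    at-u = trans (place-self c (δ u +ᵈ δ u) u) (cong₂ _+_ (Reach.δ-self G u) (Reach.δ-self G u))
    two : 2 ≤ D (c , u)
    two = ≤-reflexive (sym at-u)
    bound : place c′ (δ u) ≼ fire (c , u) (c′ , u) D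
    bound (d , g) with d C.≟ᵥ c′
    ... | no  _    = z≤n
    ... | yes refl with g G.≟ᵥ u
    ...   | no  _    = z≤n
    ...   | yes refl = subst (1 ≤_) (sym (Pebbling._⟶_.adds (s two))) (s≤s z≤n)

  -- Induction on the number of pebbles in `F`: each pair on one vertex crosses the edge as a single
  -- pebble, so a doubled distribution leaves nothing behind.
  shift : ∀ {c c′} → c C.~ c′ → ∀ F → place c (F +ᵈ F) ⇒ place c′ F
  shift {c} {c′} e F = go (size F) F refl
    where
    go : ∀ n F → size F ≡ n → place c (F +ᵈ F) ⇒ place c′ F
    go zero F eq = weaken empty
      where
      zero-at : ∀ g → F g ≡ 0
      zero-at g = n≤0⇒n≡0 (subst (F g ≤_) eq (Pebbling.term≤sum G F (G.complete g)))
      empty : place c′ F ≼ place c (F +ᵈ F)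
      empty (d , g) with d C.≟ᵥ c′
      ... | yes _ = ≤-trans (≤-reflexive (zero-at g)) z≤n
      ... | no  _ = z≤n
    go (suc n) F eq with extract F eq
    ... | u , E , F≗ , eqE =
      lift c (≗⇒ᴳ (λ g → trans (cong₂ _+_ (F≗ g) (F≗ g)) (regroup (δ u g) (E g)))) ⨾
      split c (δ u +ᵈ δ u) (E +ᵈ E) ⨾
      ⊕-cong (move-one e u) (go n E eqE) ⨾
      join c′ (δ u) E ⨾ lift c′ (≗⇒ᴳ (λ g → sym (F≗ g)))
      where
      regroup : ∀ d x → (d + x) + (d + x) ≡ (d + d) + (x + x)
      regroup = solve-∀

  dropˡ : ∀ D E → D ⊕ E ⇒ E
  dropˡ D E = weaken (λ v → m≤n+m (E v) (D v))

  -- The total cost in size is `hi D`: one pebble paid for each move and one abandoned on each odd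
  -- vertex.
  halve : ∀ {c c′} → c C.~ c′ → ∀ D → place c D ⇒ place c′ (lower D)
  halve {c} e D = weaken (place-mono c twice) ⨾ shift e (lower D)
    where
    twice : lower D +ᵈ lower D ≼ᴳ D
    twice g = ≤-trans (+-monoʳ-≤ ⌊ D g /2⌋ (⌊n/2⌋≤⌈n/2⌉ (D g))) (≤-reflexive (⌊n/2⌋+⌈n/2⌉≡n (D g)))

  -- Walks through the copies, with one or two pebbles wanted at their end.

  Walk : (ℕ → C.Vertex) → ℕ → Set
  Walk w m = ∀ i → i < m → w i C.~ w (suc i)

  shorten : ∀ {w m} → Walk w (suc m) → Walk w m
  shorten walk i i<m = walk i (m<n⇒m<1+n i<m)

  -- The copy over `w m` is left out, because the arguments below modify the last slice separately
  -- while the walk is shortened.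
  conf : (ℕ → C.Vertex) → ℕ → (ℕ → Distribution) → Distribution□
  conf w zero    p = λ _ → 0
  conf w (suc m) p = conf w m p ⊕ place (w m) (p m)

  total : ℕ → (ℕ → Distribution) → ℕ
  total zero    p = 0
  total (suc m) p = total m p + size (p m)

  module _ (v : G.Vertex) where

    halve-v : ∀ {c c′} → c C.~ c′ → ∀ l → place c ((2 * l) •ᴳ v) ⇒ place c′ (l •ᴳ v)
    halve-v {c} e l = lift c (≗⇒ᴳ (λ g → double l (δ v g))) ⨾ shift e (l •ᴳ v)
      where
      double : ∀ l d → 2 * l * d ≡ l * d + l * d
      double = solve-∀

    descend : ∀ w m l → Walk w m → place (w m) ((2 ^ m * l) •ᴳ v) ⇒ place (w 0) (l •ᴳ v)
    descend w zero    l walk = lift (w 0) (≗⇒ᴳ (λ g → cong (_* δ v g) (*-identityˡ l)))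
    descend w (suc m) l walk =
      lift (w (suc m)) (≗⇒ᴳ (λ g → cong (_* δ v g) (*-assoc 2 (2 ^ m) l))) ⨾
      halve-v (C.~-sym (walk m ≤-refl)) (2 ^ m * l) ⨾ descend w m l (shorten walk)

    halve-top : ∀ w m p R → Walk w (suc m) →
                conf w (suc m) p ⊕ place (w (suc m)) R ⇒ conf w m p ⊕ place (w m) (p m +ᵈ lower R)
    halve-top w m p R walk =
      ⊕-cong (keep (conf w (suc m) p)) (halve (C.~-sym (walk m ≤-refl)) R) ⨾
      ≗⇒ (λ u → trans (+-assoc (conf w m p u) _ _)
                      (cong (conf w m p u +_) (sym (place-⊕ (w m) (p m) (lower R) u))))

    -- If `hi R` exceeds half of the required number, the last copy alone places 2 ^ (m + 1) pebbles
    -- on `v`, which survive the m + 1 halvings down to `t`. Otherwise halving `R` costs at most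
    -- that half, and a walk one step shorter needs only the other half.
    solve-one : ∀ {t} m w p Z R → Walk w m → t C.~ w 0 →
                2 ^ suc m * N ≤ size Z + (total m p + size R) →
                place t Z ⊕ (conf w m p ⊕ place (w m) R) ⇒ place t (1 •ᴳ v)
    solve-one {t} zero w p Z R walk e h with N <? hi R
    ... | yes N< = dropˡ (place t Z) _ ⨾ dropˡ (conf w 0 p) _ ⨾
                   lift (w 0) (place-two v N<) ⨾ halve-v (C.~-sym e) 1
    ... | no  N≮ =
      ⊕-cong (keep (place t Z)) (dropˡ (conf w 0 p) _ ⨾ halve (C.~-sym e) R) ⨾
      join t Z (lower R) ⨾
      lift t (place-one v (subst (N ≤_) (sym (size-+ᵈ Z (lower R)))
        (arith N (size Z) (lo R) (hi R) (≮⇒≥ N≮) (subst (λ s → 2 * N ≤ size Z + s) (sym (lo+hi R)) h))))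
      where
      arith : ∀ n z l h → h ≤ n → 2 * n ≤ z + (l + h) → n ≤ z + l
      arith n z l h p q = linear 0 (+-mono-≤ p q) (identity n z l h)
        where
        identity : ∀ n z l h → n + (n + (z + (l + h))) + 0 ≡ z + l + (h + 2 * n)
        identity = solve-∀
    solve-one {t} (suc m) w p Z R walk e h with 2 ^ suc m * N <? hi R
    ... | yes N<hi = dropˡ (place t Z) _ ⨾ dropˡ (conf w (suc m) p) _ ⨾
                  lift (w (suc m)) (place-even (2 ^ suc m) v (m^n>0 2 (suc m)) N<hi ⨾ᴳ
                    ≗⇒ᴳ (λ g → cong (_* δ v g) (*-comm 2 (2 ^ suc m)))) ⨾
                  descend w (suc m) 2 walk ⨾ halve-v (C.~-sym e) 1
    ... | no  ≮ =
      ⊕-cong (keep (place t Z)) (halve-top w m p R walk) ⨾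
      solve-one m w p Z (p m +ᵈ lower R) (shorten walk) e
        (subst (λ s → 2 ^ suc m * N ≤ size Z + (total m p + s)) (sym (size-+ᵈ (p m) (lower R)))
          (arith (2 ^ suc m * N) N (2 ^ suc m) (size Z) (total m p) (size (p m)) (lo R) (hi R) refl (≮⇒≥ ≮)
            (subst (λ s → 2 ^ suc (suc m) * N ≤ size Z + (total m p + size (p m) + s)) (sym (lo+hi R)) h)))
      where
      arith : ∀ a n b z s q l h → a ≡ b * n → h ≤ a → 2 * b * n ≤ z + (s + q + (l + h)) → a ≤ z + (s + (q + l))
      arith a n b z s q l h refl p₁ p₂ = linear 0 (+-mono-≤ p₁ p₂) (identity b n z s q l h)
        where
        identity : ∀ b n z s q l h → b * n + (b * n + (z + (s + q + (l + h)))) + 0 ≡ z + (s + (q + l)) + (h + 2 * b * n)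
        identity = solve-∀

    -- Each of the `j` pebbles already on `v` counts as `N`, the price of making one with
    -- `place-one`. Two pebbles are sought because `w 0` will be a neighbour of the target copy.
    Solvable₂ : ℕ → Set
    Solvable₂ m = ∀ w p R j → Walk w m → j ≤ 2 ^ m →
                  2 ^ suc m * N ≤ total m p + size R + j * N →
                  conf w m p ⊕ place (w m) (R +ᵈ j •ᴳ v) ⇒ place (w 0) (2 •ᴳ v)

    -- The even number of pebbles on `v` halves exactly, so only `R` leaves remainders. The
    -- hypothesis mentions `lo R`, which is what `solve-unbalanced` estimates.
    step-down : ∀ m → Solvable₂ m → ∀ w p R h → Walk w (suc m) → h ≤ 2 ^ m →
                2 ^ suc m * N ≤ total (suc m) p + lo R + h * N →
                conf w (suc m) p ⊕ place (w (suc m)) (R +ᵈ (2 * h) •ᴳ v) ⇒ place (w 0) (2 •ᴳ v)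
    step-down m solve w p R h walk h≤ enough =
      halve-top w m p (R +ᵈ (2 * h) •ᴳ v) walk ⨾
      ⊕-cong (keep (conf w m p))
        (lift (w m) (≗⇒ᴳ (λ g → trans (cong (p m g +_) (half-+ (R g) h (δ v g))) (sym (+-assoc (p m g) _ _))))) ⨾
      solve w p (p m +ᵈ lower R) h (shorten walk) h≤
        (subst (λ s → 2 ^ suc m * N ≤ s + h * N)
          (trans (+-assoc (total m p) _ _) (cong (total m p +_) (sym (size-+ᵈ (p m) (lower R))))) enough)
      where
      double-+ : ∀ r x → ⌊ x + x + r /2⌋ ≡ ⌊ r /2⌋ + x
      double-+ r zero    = sym (+-identityʳ _)
      double-+ r (suc x) rewrite +-suc x x = trans (cong suc (double-+ r x)) (sym (+-suc _ x))
      half-+ : ∀ r h d → ⌊ r + 2 * h * d /2⌋ ≡ ⌊ r /2⌋ + h * d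
      half-+ r h d = trans (cong ⌊_/2⌋ (regroup r h d)) (double-+ r (h * d))
        where
        regroup : ∀ r h d → r + 2 * h * d ≡ h * d + h * d + r
        regroup = solve-∀

    -- Put l = 2 ^ (m + 1) - h. If `hi R` exceeds lN, then `R` adds 2l pebbles to the 2h on `v`, and
    -- these 2 ^ (m + 2) pebbles descend to two. Otherwise halving costs at most lN on `R` and hN on
    -- the pebbles at `v`, together no more than the 2 ^ (m + 1) N by which the requirement falls.
    solve-even : ∀ m → Solvable₂ m → ∀ w p R h → Walk w (suc m) → h ≤ 2 ^ m →
                 2 ^ suc (suc m) * N ≤ total (suc m) p + size R + 2 * h * N →
                 conf w (suc m) p ⊕ place (w (suc m)) (R +ᵈ (2 * h) •ᴳ v) ⇒ place (w 0) (2 •ᴳ v)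
    solve-even m solve w p R h walk h≤ enough with (2 ^ suc m ∸ h) * N <? hi R
    ... | yes N<hi =
      dropˡ (conf w (suc m) p) _ ⨾
      lift (w (suc m)) (+ᵈ-congˡ ((2 * h) •ᴳ v) (place-even l v 0<l N<hi) ⨾ᴳ
        ≗⇒ᴳ (λ g → trans (regroup l h (δ v g)) (cong (λ s → s * 2 * δ v g) l+h))) ⨾
      descend w (suc m) 2 walk
      where
      l = 2 ^ suc m ∸ h
      h< : h < 2 ^ suc m
      h< = ≤-<-trans h≤ (^-monoʳ-< 2 (s≤s (s≤s z≤n)) (n<1+n m))
      0<l : 0 < l
      0<l = m<n⇒0<n∸m h<
      l+h : l + h ≡ 2 ^ suc m
      l+h = m∸n+n≡m (<⇒≤ h<)
      regroup : ∀ l h d → 2 * l * d + 2 * h * d ≡ (l + h) * 2 * d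
      regroup = solve-∀
    ... | no  ≮ = step-down m solve w p R h walk h≤
      (arith (2 ^ suc m) (2 ^ suc m ∸ h) N (total (suc m) p) (lo R) (hi R) h
        (m∸n+n≡m (≤-trans h≤ (^-monoʳ-≤ 2 (n≤1+n m)))) (≮⇒≥ ≮)
        (subst (λ s → 2 ^ suc (suc m) * N ≤ total (suc m) p + s + 2 * h * N) (sym (lo+hi R)) enough))
      where
      arith : ∀ b d n s l u h → d + h ≡ b → u ≤ d * n → 2 * b * n ≤ s + (l + u) + 2 * h * n →
              b * n ≤ s + l + h * n
      arith b d n s l u h refl p q = linear 0 (+-mono-≤ p q) (identity d n s l u h)
        where
        identity : ∀ d n s l u h → (d + h) * n + (d * n + (s + (l + u) + 2 * h * n)) + 0 ≡
                                   s + l + h * n + (u + 2 * (d + h) * n)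
        identity = solve-∀

    -- Parity is repaired by making one more pebble on `v` from `R` or, if `R` has fewer than `N`
    -- pebbles, by dropping one. In the latter case dropping and halving cost at most (h + 2)N, and
    -- h + 2 ≤ 2 ^ (m + 1) since h < 2 ^ m.
    solve-odd : ∀ m → Solvable₂ m → ∀ w p R h → Walk w (suc m) → h < 2 ^ m →
                2 ^ suc (suc m) * N ≤ total (suc m) p + size R + suc (2 * h) * N →
                conf w (suc m) p ⊕ place (w (suc m)) (R +ᵈ (suc (2 * h)) •ᴳ v) ⇒ place (w 0) (2 •ᴳ v)
    solve-odd m solve w p R h walk h< enough with N ≤? size R
    ... | yes N≤ with subdistribution N R N≤
    ...   | E , E≼R , sizeE =
      ⊕-cong (keep (conf w (suc m) p)) (lift (w (suc m)) (
        +ᵈ-congˡ _ (≗⇒ᴳ (λ g → sym (m∸n+n≡m (E≼R g))) ⨾ᴳ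
                    +ᵈ-cong (keepᴳ (R -ᵈ E)) (place-one v (≤-reflexive (sym sizeE)))) ⨾ᴳ
        ≗⇒ᴳ (λ g → regroup ((R -ᵈ E) g) h (δ v g)))) ⨾
      solve-even m solve w p (R -ᵈ E) (suc h) walk h<
        (arith (2 ^ suc (suc m) * N) N (total (suc m) p) (size (R -ᵈ E)) h
          (subst (λ s → 2 ^ suc (suc m) * N ≤ total (suc m) p + s + suc (2 * h) * N)
            (trans (sym (size-⊖ E≼R)) (cong (_+ size (R -ᵈ E)) sizeE)) enough))
      where
      regroup : ∀ r h d → r + 1 * d + suc (2 * h) * d ≡ r + 2 * suc h * d
      regroup = solve-∀
      arith : ∀ a n s r h → a ≤ s + (n + r) + suc (2 * h) * n → a ≤ s + r + 2 * suc h * n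
      arith a n s r h = subst (a ≤_) (identity n s r h)
        where
        identity : ∀ n s r h → s + (n + r) + suc (2 * h) * n ≡ s + r + 2 * suc h * n
        identity = solve-∀
    solve-odd m solve w p R h walk h< enough | no N≰ =
      ⊕-cong (keep (conf w (suc m) p))
        (lift (w (suc m)) (weakenᴳ (λ g → +-monoʳ-≤ (R g) (*-monoˡ-≤ (δ v g) (n≤1+n (2 * h)))))) ⨾
      step-down m solve w p R h walk (<⇒≤ h<)
        (arith (2 ^ m) N (total (suc m) p) (lo R) (hi R) h h< (m^n>0 2 m)
          (≤-trans (hi≤size R) (<⇒≤ (≰⇒> N≰)))
          (subst (λ s → 2 ^ suc (suc m) * N ≤ total (suc m) p + s + suc (2 * h) * N) (sym (lo+hi R)) enough))
      where
      arith : ∀ b n s l u h → h < b → 0 < b → u ≤ n → 2 * (2 * b) * n ≤ s + (l + u) + suc (2 * h) * n →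
              2 * b * n ≤ s + l + h * n
      arith b n s l u h p₁ p₂ q r =
        linear 0 (+-mono-≤ (+-mono-≤ (*-monoˡ-≤ n p₁) (*-monoˡ-≤ n p₂)) (+-mono-≤ q r)) (identity b n s l u h)
        where
        identity : ∀ b n s l u h →
          2 * b * n + (b * n + b * n + (n + (s + (l + u) + suc (2 * h) * n))) + 0 ≡
          s + l + h * n + (suc h * n + 1 * n + (u + 2 * (2 * b) * n))
        identity = solve-∀

    -- The v-pebbles count N each, but they may not exceed half of the 2 ^ suc m
    -- required: with nearly all of them on one copy, a bad parity wastes them.
    solve-two : ∀ m → Solvable₂ m
    solve-two zero w p R zero walk j≤ enough =
      dropˡ (conf w 0 p) _ ⨾
      lift (w 0) (weakenᴳ (λ g → m≤m+n (R g) 0) ⨾ᴳ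
        place-many 2 v (subst (2 * N ≤_) (+-identityʳ (size R)) enough))
    solve-two zero w p R (suc zero) walk j≤ enough =
      dropˡ (conf w 0 p) _ ⨾
      lift (w 0) (+ᵈ-congˡ (1 •ᴳ v) (place-one v (arith N (size R) enough)) ⨾ᴳ •ᴳ-+ 1 1 v)
      where
      arith : ∀ n r → 2 * n ≤ r + 1 * n → n ≤ r
      arith n r h = linear 0 h (identity n r)
        where
        identity : ∀ n r → n + (r + 1 * n) + 0 ≡ r + 2 * n
        identity = solve-∀
    solve-two zero w p R (suc (suc j)) walk (s≤s ()) enough
    solve-two (suc m) w p R j walk j≤ enough with even⊎odd j
    ... | h , inj₁ refl = solve-even m (solve-two m) w p R h walk (*-cancelˡ-≤ 2 j≤) enough
    ... | h , inj₂ refl = solve-odd m (solve-two m) w p R h walk (*-cancelˡ-< 2 _ _ j≤) enough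

-- The case analysis for two walks from the target to adjacent antipodal copies.

module TwoWalks (C G : Graph) (odd₂ : OddTwoPebbling G) (v : Graph.Vertex G)
                (t : Graph.Vertex C) (Z : Pebbling.Distribution G) where
  open Graph C using (_~_; ~-sym)
  open Pebbling G using (Distribution; size; δ)
  open Reach G using (lower; lo; hi; lo+hi)
    renaming (_⊕_ to _+ᵈ_; _•_ to _•ᴳ_; size-⊕ to size-+ᵈ; _⨾_ to _⨾ᴳ_; ≗⇒ to ≗⇒ᴳ)
  open Reach (C □ G) using (_⊕_; _⇒_; keep; ≗⇒; _⨾_; ⊕-cong; ⊕-comm)
  open OddCopies G odd₂ using (N; hi≤lo+N; place-two; place-even; place-even-with-pairs)
  open Product C G odd₂

  -- x 0 and y 0 are the neighbours of the target t, and x m and y m are adjacent.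
  Start : ℕ → (x y : ℕ → Graph.Vertex C) (p q : ℕ → Distribution) → Pebbling.Distribution (C □ G)
  Start m x y p q = place t Z ⊕ (conf x (suc m) p ⊕ conf y (suc m) q)

  -- 8b + 3 is the bound for the cycle from `CycleLowerBound`. The antipodal slices enter as `lo`
  -- plus `hi`, since these parts are spent differently.
  Enough : ℕ → ℕ → (p q : ℕ → Distribution) → Set
  Enough b m p q = (8 * b + 3) * N ≤ size Z + ((total m p + (lo (p m) + hi (p m))) +
                                              (total m q + (lo (q m) + hi (q m))))

  swap-Start : ∀ m x y p q → Start m x y p q ⇒ Start m y x q p
  swap-Start m x y p q = ⊕-cong (keep (place t Z)) (⊕-comm (conf x (suc m) p) (conf y (suc m) q))

  swap-Enough : ∀ b m p q → Enough b m p q → Enough b m q p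
  swap-Enough b m p q = subst (λ s → (8 * b + 3) * N ≤ size Z + s)
    (+-comm (total m p + (lo (p m) + hi (p m))) (total m q + (lo (q m) + hi (q m))))

  size-+lower : ∀ D E → size (D +ᵈ lower E) ≡ lo D + hi D + lo E
  size-+lower D E = trans (size-+ᵈ D (lower E)) (cong (_+ lo E) (sym (lo+hi D)))

  cross-pairs : ∀ m x y p q → x m ~ y m →
    Start m x y p q ⇒ place t Z ⊕ (conf x m p ⊕ place (x m) (p m +ᵈ lower (q m)))
  cross-pairs m x y p q e = ⊕-cong (keep (place t Z))
    (⊕-cong (keep (conf x (suc m) p)) (dropˡ (conf y m q) _ ⨾ halve (~-sym e) (q m)) ⨾
     ≗⇒ (λ u → trans (+-assoc (conf x m p u) _ _)
                     (cong (conf x m p u +_) (sym (place-⊕ (x m) (p m) (lower (q m)) u)))))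

  solve-cross : ∀ b m x y p q → Walk x m → t ~ x 0 → x m ~ y m → 2 ^ m ≡ 3 * b + 1 → Enough b m p q →
    total m q + hi (q m) ≤ (2 * b + 1) * N → Start m x y p q ⇒ place t (1 •ᴳ v)
  solve-cross b m x y p q walk t~x e 2^m enough few =
    cross-pairs m x y p q e ⨾
    solve-one v m x p Z (p m +ᵈ lower (q m)) walk t~x
      (subst₂ (λ a s → 2 * a * N ≤ size Z + (total m p + s)) (sym 2^m) (sym (size-+lower (p m) (q m)))
        (arith b N (size Z) (total m p) (lo (p m)) (hi (p m)) (total m q) (lo (q m)) (hi (q m)) few enough))
    where
    arith : ∀ b n z s l h s′ l′ h′ → s′ + h′ ≤ (2 * b + 1) * n →
            (8 * b + 3) * n ≤ z + ((s + (l + h)) + (s′ + (l′ + h′))) →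
            2 * (3 * b + 1) * n ≤ z + (s + (l + h + l′))
    arith b n z s l h s′ l′ h′ p₁ p₂ = linear 0 (+-mono-≤ p₁ p₂) (identity b n z s l h s′ l′ h′)
      where
      identity : ∀ b n z s l h s′ l′ h′ →
        2 * (3 * b + 1) * n + ((2 * b + 1) * n + (z + ((s + (l + h)) + (s′ + (l′ + h′))))) + 0 ≡
        z + (s + (l + h + l′)) + (s′ + h′ + (8 * b + 3) * n)
      identity = solve-∀

  -- The case k = 0 is separate because no copy on `y` precedes the antipodal one. Here `y 0` is
  -- itself next to the target, so two pebbles on `v` there are enough.
  solve-triangle : ∀ x y p q → t ~ x 0 → t ~ y 0 → x 0 ~ y 0 → Enough 0 0 p q →
                   Start 0 x y p q ⇒ place t (1 •ᴳ v)
  solve-triangle x y p q t~x t~y e enough with hi (q 0) ≤? (2 * 0 + 1) * N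
  ... | yes few = solve-cross 0 0 x y p q (λ _ ()) t~x e refl enough few
  ... | no ¬few = dropˡ (place t Z) _ ⨾ dropˡ (conf x 1 p) _ ⨾ dropˡ (conf y 0 q) _ ⨾
    lift (y 0) (place-two v (subst (_< hi (q 0)) (*-identityˡ N) (≰⇒> ¬few))) ⨾ halve-v v (~-sym t~y) 1

  module _ (μ b′ : ℕ) (2^m : 2 ^ suc μ ≡ 3 * suc b′ + 1) where
    private
      m = suc μ
      b = suc b′

    -- `solve-two` will start over `y μ` with b + 1 pebbles on `v`, and its cap is 2 ^ μ. As b ≥ 1,
    -- 2(b + 1) ≤ 3b + 1.
    b<2^μ : b < 2 ^ μ
    b<2^μ = *-cancelˡ-≤ 2 (subst (2 * suc b ≤_) (sym 2^m) (linear b′ (z≤n {0}) (identity b′)))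
      where
      identity : ∀ b′ → 2 * suc (suc b′) + 0 + b′ ≡ 3 * suc b′ + 1 + 0
      identity = solve-∀

    gather : ∀ (c : Graph.Vertex C) (W : Pebbling.Distribution (C □ G)) β D F →
      place c (β •ᴳ v) ⊕ ((W ⊕ place c D) ⊕ (place c (1 •ᴳ v) ⊕ place c F)) ⇒
      W ⊕ place c (D +ᵈ F +ᵈ suc β •ᴳ v)
    gather c W β D F =
      ≗⇒ (λ u → trans (regroup (place c (β •ᴳ v) u) (W u) (place c D u) (place c (1 •ᴳ v) u) (place c F u))
                      (cong (W u +_) (sym (place-sum u)))) ⨾
      ⊕-cong (keep W) (lift c (≗⇒ᴳ (λ g → cong ((D +ᵈ F) g +_) (sym (*-distribʳ-+ (δ v g) 1 β)))))
      where
      place-sum : ∀ u → place c (D +ᵈ F +ᵈ (1 •ᴳ v +ᵈ β •ᴳ v)) u ≡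
                  place c D u + place c F u + (place c (1 •ᴳ v) u + place c (β •ᴳ v) u)
      place-sum u = trans (place-⊕ c (D +ᵈ F) (1 •ᴳ v +ᵈ β •ᴳ v) u)
        (cong₂ _+_ (place-⊕ c D F u) (place-⊕ c (1 •ᴳ v) (β •ᴳ v) u))
      regroup : ∀ β w d o φ → β + ((w + d) + (o + φ)) ≡ w + (d + φ + (o + β))
      regroup = solve-∀

    module _ (x y : ℕ → Graph.Vertex C) (p q : ℕ → Distribution) (walkˣ : Walk x m) (walkʸ : Walk y m)
             (t~x : t ~ x 0) (t~y : t ~ y 0) (e : x m ~ y m) (enough : Enough b m p q) where
      private
        down : y m ~ y μ
        down = ~-sym (walkʸ μ ≤-refl)

      -- The copy over `x m` places 4b pebbles on `v`; crossing to `y m` and going down to `y μ`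
      -- leaves b. The copy over `y m` turns its own two into one more, and its pairs into `F`.
      pour : ∀ {F} → 2 * b * N < hi (p m) →
             Reach._⇒_ G (q m) ((2 * 1) •ᴳ v +ᵈ (F +ᵈ F)) →
             Start m x y p q ⇒ conf y μ q ⊕ place (y μ) (q μ +ᵈ F +ᵈ suc b •ᴳ v)
      pour {F} heavyˣ Q⇒ =
        dropˡ (place t Z) (conf x (suc m) p ⊕ conf y (suc m) q) ⨾
        ⊕-cong left (⊕-cong (keep (conf y m q)) right) ⨾
        gather (y μ) (conf y μ q) b (q μ) F
        where
        left : conf x (suc m) p ⇒ place (y μ) (b •ᴳ v)
        left = dropˡ (conf x m p) (place (x m) (p m)) ⨾ lift (x m) (place-even (2 * b) v z<s heavyˣ) ⨾
               halve-v v e (2 * b) ⨾ halve-v v down b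
        right : place (y m) (q m) ⇒ place (y μ) (1 •ᴳ v) ⊕ place (y μ) F
        right = lift (y m) Q⇒ ⨾ split (y m) ((2 * 1) •ᴳ v) (F +ᵈ F) ⨾ ⊕-cong (halve-v v down 1) (shift down F)

      solve-both-heavy : 2 * b * N < hi (p m) → N < hi (q m) → Start m x y p q ⇒ place t (1 •ᴳ v)
      solve-both-heavy heavyˣ heavyʸ = [ solve-cross b m x y p q walkˣ t~x e 2^m enough , many ]′
        (≤-<-connex (total m q + hi (q m)) ((2 * b + 1) * N))
        where
        -- `F` has size `hi (q m)` - N - 1, and the strictness of `large` returns that 1. So at
        -- least 2bN pebbles remain, and the b + 1 on `v` bring the worth to (3b + 1)N.
        arith : ∀ b n s s₁ h f → suc (1 * n) + f ≡ h → (2 * b + 1) * n < s + s₁ + h →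
                (3 * b + 1) * n ≤ s + (s₁ + f) + suc b * n
        arith b n s s₁ h f refl p₁ = linear 0 p₁ (identity b n s s₁ f)
          where
          identity : ∀ b n s s₁ f → (3 * b + 1) * n + (s + s₁ + (suc (1 * n) + f)) + 0 ≡
                                    s + (s₁ + f) + suc b * n + suc ((2 * b + 1) * n)
          identity = solve-∀
        many : (2 * b + 1) * N < total m q + hi (q m) → Start m x y p q ⇒ place t (1 •ᴳ v)
        many large =
          let F , Q⇒ , hiQ = place-even-with-pairs 1 (q m) v z<s (subst (_< hi (q m)) (sym (*-identityˡ N)) heavyʸ)
          in pour heavyˣ Q⇒ ⨾
             solve-two v μ y q (q μ +ᵈ F) (suc b) (shorten walkʸ) b<2^μ
               (subst₂ (λ a s → a * N ≤ total μ q + s + suc b * N) (sym 2^m) (sym (size-+ᵈ (q μ) F))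
                 (arith b N (total μ q) (size (q μ)) (hi (q m)) (size F) hiQ large)) ⨾
             halve-v v (~-sym t~y) 1

      -- Sending `lo (p m)` across costs at most 2bN, and halving the union `R` keeps at least (size
      -- R - N) / 2. As the abandoned part of `x` is no larger than that of `y`, twice the number
      -- passed to `solve-one` is at least (8b + 3)N - 2bN - N = 2(3b + 1)N.
      solve-light : hi (p m) ≤ 2 * b * N → total m p ≤ total m q → Start m x y p q ⇒ place t (1 •ᴳ v)
      solve-light light X≤Y =
        swap-Start m x y p q ⨾ cross-pairs m y x q p (~-sym e) ⨾
        ⊕-cong (keep (place t Z)) (halve-top v y μ q R walkʸ) ⨾
        solve-one v μ y q Z (q μ +ᵈ lower R) (shorten walkʸ) t~y
          (subst₂ (λ a s → a * N ≤ size Z + (total μ q + s)) (sym 2^m) (sym (size-+ᵈ (q μ) (lower R)))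
            (*-cancelˡ-≤ 2 (arith b N (size Z) (total m p) (lo (p m)) (hi (p m)) (total μ q) (size (q μ))
              (lo (q m)) (hi (q m)) (lo R) (hi R) enough light X≤Y (hi≤lo+N R)
              (trans (lo+hi R) (size-+lower (q m) (p m))))))
        where
        R = q m +ᵈ lower (p m)
        arith : ∀ b n z s l h s₀ s₁ l′ h′ r u →
                (8 * b + 3) * n ≤ z + ((s + (l + h)) + (s₀ + s₁ + (l′ + h′))) →
                h ≤ 2 * b * n → s ≤ s₀ + s₁ → u ≤ r + n → r + u ≡ l′ + h′ + l →
                2 * ((3 * b + 1) * n) ≤ 2 * (z + (s₀ + (s₁ + r)))
        arith b n z s l h s₀ s₁ l′ h′ r u p₁ p₂ p₃ p₄ p₅ =
          linear z (+-mono-≤ p₁ (+-mono-≤ p₂ (+-mono-≤ p₃ (+-mono-≤ p₄ (≤-reflexive (sym p₅))))))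
                   (identity b n z s l h s₀ s₁ l′ h′ r u)
          where
          identity : ∀ b n z s l h s₀ s₁ l′ h′ r u →
            2 * ((3 * b + 1) * n) +
              (z + ((s + (l + h)) + (s₀ + s₁ + (l′ + h′))) + (2 * b * n + (s₀ + s₁ + (r + n + (r + u))))) + z ≡
            2 * (z + (s₀ + (s₁ + r))) + ((8 * b + 3) * n + (h + (s + (u + (l′ + h′ + l)))))
          identity = solve-∀

      pour-across : ∀ {F} → Reach._⇒_ G (q m) ((2 * (2 * b)) •ᴳ v +ᵈ (F +ᵈ F)) →
                    Start m x y p q ⇒ conf x m p ⊕ place (x m) (p m +ᵈ F +ᵈ (2 * b) •ᴳ v)
      pour-across {F} Q⇒ =
        dropˡ (place t Z) (conf x (suc m) p ⊕ conf y (suc m) q) ⨾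
        ⊕-cong (keep (conf x (suc m) p)) right ⨾
        ≗⇒ (λ u → trans (regroup (conf x m p u) (place (x m) (p m) u) (place (x m) ((2 * b) •ᴳ v) u) (place (x m) F u))
                        (cong (conf x m p u +_) (sym (place-sum u))))
        where
        right : conf y (suc m) q ⇒ place (x m) ((2 * b) •ᴳ v) ⊕ place (x m) F
        right = dropˡ (conf y m q) (place (y m) (q m)) ⨾ lift (y m) Q⇒ ⨾
                split (y m) ((2 * (2 * b)) •ᴳ v) (F +ᵈ F) ⨾
                ⊕-cong (halve-v v (~-sym e) (2 * b)) (shift (~-sym e) F)
        place-sum : ∀ u → place (x m) (p m +ᵈ F +ᵈ (2 * b) •ᴳ v) u ≡
                    place (x m) (p m) u + place (x m) F u + place (x m) ((2 * b) •ᴳ v) u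
        place-sum u = trans (place-⊕ (x m) (p m +ᵈ F) ((2 * b) •ᴳ v) u)
                            (cong (_+ place (x m) ((2 * b) •ᴳ v) u) (place-⊕ (x m) (p m) F u))
        regroup : ∀ c d o φ → (c + d) + (o + φ) ≡ c + (d + φ + o)
        regroup = solve-∀

      solve-unbalanced : hi (p m) ≤ N → 2 * b * N < hi (q m) → Start m x y p q ⇒ place t (1 •ᴳ v)
      solve-unbalanced light heavy =
        [ (λ few → swap-Start m x y p q ⨾
            solve-cross b m y x q p walkʸ t~y (~-sym e) 2^m (swap-Enough b m p q enough) few)
        , (λ many → [ own-side , across many ]′ (≤-<-connex ((3 * b + 1) * N) own))
        ]′ (≤-<-connex (total m p + hi (p m)) ((2 * b + 1) * N))
        where
        own = size Z + (total μ q + (size (q μ) + lo (q m)))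
        own-side : (3 * b + 1) * N ≤ own → Start m x y p q ⇒ place t (1 •ᴳ v)
        own-side large =
          ⊕-cong (keep (place t Z)) (dropˡ (conf x (suc m) p) (conf y (suc m) q) ⨾ halve-top v y μ q (q m) walkʸ) ⨾
          solve-one v μ y q Z (q μ +ᵈ lower (q m)) (shorten walkʸ) t~y
            (subst₂ (λ a s → a * N ≤ size Z + (total μ q + s)) (sym 2^m) (sym (size-+ᵈ (q μ) (lower (q m)))) large)
        -- Here `F` has size `hi (q m)` - 2bN - 1, and twice `lo R` is at least size R - N. By the
        -- third and fourth hypotheses the rest of `x` holds more than 2bN pebbles, and these count
        -- twice. The final slack is (b - 1)N + 1, which uses b ≥ 1.
        arith : ∀ b′ n z s l h s₀ s₁ l′ h′ f r u → let b = suc b′ in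
                suc (2 * b * n) + f ≡ h′ →
                (8 * b + 3) * n ≤ z + ((s + (l + h)) + (s₀ + s₁ + (l′ + h′))) →
                (2 * b + 1) * n < s + h → h ≤ n → z + (s₀ + (s₁ + l′)) < (3 * b + 1) * n →
                u ≤ r + n → r + u ≡ l + h + f →
                2 * ((3 * b + 1) * n) ≤ 2 * (s + r + b * n)
        arith b′ n z s l h s₀ s₁ l′ h′ f r u refl p₁ p₂ p₃ p₄ p₅ p₆ =
          linear (suc (b′ * n))
            (+-mono-≤ p₁ (+-mono-≤ p₂ (+-mono-≤ p₃ (+-mono-≤ p₄ (+-mono-≤ p₅ (≤-reflexive (sym p₆)))))))
            (identity b′ n z s l h s₀ s₁ l′ f r u)
          where
          identity : ∀ b′ n z s l h s₀ s₁ l′ f r u →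
            2 * ((3 * suc b′ + 1) * n) +
              (z + ((s + (l + h)) + (s₀ + s₁ + (l′ + (suc (2 * suc b′ * n) + f)))) +
                (s + h + (n + ((3 * suc b′ + 1) * n + (r + n + (r + u)))))) + suc (b′ * n) ≡
            2 * (s + r + suc b′ * n) +
              ((8 * suc b′ + 3) * n + (suc ((2 * suc b′ + 1) * n) + (h + (suc (z + (s₀ + (s₁ + l′))) + (u + (l + h + f))))))
          identity = solve-∀
        across : (2 * b + 1) * N < total m p + hi (p m) → own < (3 * b + 1) * N →
                 Start m x y p q ⇒ place t (1 •ᴳ v)
        across many small =
          let F , Q⇒ , hiQ = place-even-with-pairs (2 * b) (q m) v z<s heavy
              R = p m +ᵈ F
          in pour-across Q⇒ ⨾
             step-down v μ (solve-two v μ) x p R b walkˣ (<⇒≤ b<2^μ)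
               (subst (λ a → a * N ≤ total m p + lo R + b * N) (sym 2^m)
                 (*-cancelˡ-≤ 2 (arith b′ N (size Z) (total m p) (lo (p m)) (hi (p m)) (total μ q) (size (q μ))
                   (lo (q m)) (hi (q m)) (size F) (lo R) (hi R) hiQ enough many light small (hi≤lo+N R)
                   (trans (lo+hi R) (trans (size-+ᵈ (p m) F) (cong (_+ size F) (sym (lo+hi (p m))))))))) ⨾
             halve-v v (~-sym t~x) 1

    solve-one-heavy : ∀ x y p q → Walk x m → Walk y m → t ~ x 0 → t ~ y 0 → x m ~ y m → Enough b m p q →
      2 * b * N < hi (q m) → Start m x y p q ⇒ place t (1 •ᴳ v)
    solve-one-heavy x y p q walkˣ walkʸ t~x t~y e enough heavy =
      [ (λ light → solve-unbalanced x y p q walkˣ walkʸ t~x t~y e enough light heavy)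
      -- `solve-both-heavy` takes its 4b pebbles from its first walk, so the walks exchange roles.
      , (λ N< → swap-Start m x y p q ⨾
          solve-both-heavy y x q p walkʸ walkˣ t~y t~x (~-sym e) (swap-Enough b m p q enough) heavy N<)
      ]′ (≤-<-connex (hi (p m)) N)

    -- If neither antipodal copy is heavy, the walk whose other copies hold fewer pebbles is
    -- sacrificed. Otherwise symmetry puts a heavy one on `y`.
    solve-long : ∀ x y p q → Walk x m → Walk y m → t ~ x 0 → t ~ y 0 → x m ~ y m → Enough b m p q →
                 Start m x y p q ⇒ place t (1 •ᴳ v)
    solve-long x y p q walkˣ walkʸ t~x t~y e enough =
      [ (λ q≤ → [ (λ p≤ →
            [ solve-light x y p q walkˣ walkʸ t~x t~y e enough p≤
            , (λ Y≤X → swap-Start m x y p q ⨾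
                solve-light y x q p walkʸ walkˣ t~y t~x (~-sym e) (swap-Enough b m p q enough) q≤ Y≤X)
            ]′ (≤-total (total m p) (total m q)))
        , (λ p> → swap-Start m x y p q ⨾
            solve-one-heavy y x q p walkʸ walkˣ t~y t~x (~-sym e) (swap-Enough b m p q enough) p>)
        ]′ (≤-<-connex (hi (p m)) (2 * b * N)))
      , solve-one-heavy x y p q walkˣ walkʸ t~x t~y e enough
      ]′ (≤-<-connex (hi (q m)) (2 * b * N))

-- Weight functions that no move increases.

module Weight (H : Graph) (wt : Graph.Vertex H → ℕ) where
  open Graph H
  open Pebbling H
  open Reach H

  weight : Distribution → ℕ
  weight D = size (λ v → wt v * D v)

  weight-⊕ : ∀ D E → weight (D ⊕ E) ≡ weight D + weight E
  weight-⊕ D E = trans (size-≗ (λ v → *-distribˡ-+ (wt v) (D v) (E v)))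
                       (size-⊕ (λ v → wt v * D v) (λ v → wt v * E v))

  weight-• : ∀ n u → weight (n • u) ≡ n * wt u
  weight-• n u = trans (size-≗ at)
    (trans (sum-map-* (n * wt u) (δ u) vertices) (trans (cong (n * wt u *_) (size-δ u)) (*-identityʳ _)))
    where
    at : ∀ v → wt v * (n • u) v ≡ n * wt u * δ u v
    at v with v ≟ᵥ u
    ... | yes refl = regroup (wt u) n
      where
      regroup : ∀ w n → w * (n * 1) ≡ n * w * 1
      regroup = solve-∀
    ... | no  _    = trans (cong (wt v *_) (*-zeroʳ n)) (trans (*-zeroʳ (wt v)) (sym (*-zeroʳ (n * wt u))))

  term≤weight : ∀ D v → wt v * D v ≤ weight D
  term≤weight D v = term≤sum (λ v → wt v * D v) (complete v)

  -- Both distributions share `D ⊖ 2 • u`; the move replaces two pebbles of weight `wt u` by one of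
  -- weight `wt w`.
  weight-⟶ : ∀ {D D′} (s : D ⟶ D′) → wt (_⟶_.target s) ≤ 2 * wt (_⟶_.source s) →
             weight D′ ≤ weight D
  weight-⟶ {D} {D′} (move u w e r a o) wt≤ = begin
    weight D′                    ≡⟨ size-≗ (λ v → cong (wt v *_) (after v)) ⟩
    weight (E ⊕ 1 • w)           ≡⟨ weight-⊕ E (1 • w) ⟩
    weight E + weight (1 • w)    ≡⟨ cong (weight E +_) (trans (weight-• 1 w) (*-identityˡ _)) ⟩
    weight E + wt w              ≤⟨ +-monoʳ-≤ (weight E) wt≤ ⟩
    weight E + 2 * wt u          ≡⟨ cong (weight E +_) (weight-• 2 u) ⟨
    weight E + weight (2 • u)    ≡⟨ weight-⊕ E (2 • u) ⟨
    weight (E ⊕ 2 • u)           ≡⟨ size-≗ (λ v → cong (wt v *_) (before v)) ⟩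
    weight D                     ∎
    where
    open ≤-Reasoning
    E = D ⊖ 2 • u
    before : ∀ v → (E ⊕ 2 • u) v ≡ D v
    before v = m∸n+n≡m 2δ≤
      where
      2δ≤ : 2 * δ u v ≤ D v
      2δ≤ with v ≟ᵥ u
      ... | yes refl = subst (2 ≤_) (sym r) (s≤s (s≤s z≤n))
      ... | no  _    = z≤n
    after : ∀ v → D′ v ≡ (E ⊕ 1 • w) v
    after v with v ≟ᵥ u | v ≟ᵥ w
    ... | yes refl | yes refl = ⊥-elim (~-irrefl refl e)
    ... | yes refl | no  _    = trans (cong (_∸ 2) (sym r)) (sym (+-identityʳ _))
    ... | no  _    | yes refl = trans a (+-comm 1 _)
    ... | no  v≢u  | no  v≢w  = trans (o v v≢u v≢w) (sym (+-identityʳ _))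

-- A lower bound for the pebbling number of an odd cycle.

module CycleLowerBound (n : ℕ) (3≤n : 3 ≤ n) where
  private
    C = cycle n 3≤n
  open Graph C
  open Pebbling C
  open Reach C
  -- A pebble reaching 0 through n - 1 needs weight 2 ^ n upwards, and through 1
  -- it needs weight 2 ^ n downwards.
  module Up = Weight C (λ i → 2 ^ toℕ i)
  module Down = Weight C (λ i → 2 ^ (n ∸ toℕ i))

  origin : Fin n
  origin = fromℕ< (≤-trans (s≤s z≤n) 3≤n)

  toℕ-origin : toℕ origin ≡ 0
  toℕ-origin = toℕ-fromℕ< _

  Light : Distribution → Set
  Light D = D origin ≡ 0 × Up.weight D < 2 ^ n × Down.weight D < 2 ^ n

  double-n∸ : ∀ {i} → i < n → 2 ^ (n ∸ i) ≡ 2 * 2 ^ (n ∸ suc i)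
  double-n∸ {i} i<n = cong (2 ^_) (sym (trans (sym (+-∸-assoc 1 i<n)) refl))

  -- Two pebbles on n - 1 already have upward weight 2 ^ n, and two on 1 have downward weight 2 ^ n,
  -- so no move enters the origin; none leaves it, as it is empty. All other moves satisfy the
  -- hypothesis of `weight-⟶` for both weights.
  light-⟶ : ∀ {D D′} → D ⟶ D′ → Light D → Light D′
  light-⟶ {D} {D′} s@(move u w e r a o) (D0 , up , down) =
    trans (o origin (λ { refl → u≢0 toℕ-origin }) (λ { refl → w≢0 toℕ-origin })) D0 ,
    ≤-<-trans (Up.weight-⟶ s (wtUp e)) up ,
    ≤-<-trans (Down.weight-⟶ s (wtDown e)) down
    where
    2≤D : 2 ≤ D u
    2≤D = subst (2 ≤_) (sym r) (s≤s (s≤s z≤n))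
    2≰0 : ¬ (2 ≤ 0)
    2≰0 ()
    u≢0 : toℕ u ≢ 0
    u≢0 u≡0 = 2≰0 (subst (2 ≤_) D0 (subst (λ x → 2 ≤ D x) (toℕ-injective (trans u≡0 (sym toℕ-origin))) 2≤D))
    notUp : suc (toℕ u) ≢ n
    notUp 1+u≡n = <⇒≱ up (begin
      2 ^ n                ≡⟨ cong (2 ^_) 1+u≡n ⟨
      2 * 2 ^ toℕ u        ≡⟨ *-comm 2 (2 ^ toℕ u) ⟩
      2 ^ toℕ u * 2        ≤⟨ *-monoʳ-≤ (2 ^ toℕ u) 2≤D ⟩
      2 ^ toℕ u * D u      ≤⟨ Up.term≤weight D u ⟩
      Up.weight D          ∎)
      where open ≤-Reasoning
    notDown : toℕ u ≢ 1
    notDown u≡1 = <⇒≱ down (begin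
      2 ^ n                    ≡⟨ double-n∸ (≤-trans (s≤s z≤n) 3≤n) ⟩
      2 * 2 ^ (n ∸ 1)          ≡⟨ cong (λ i → 2 * 2 ^ (n ∸ i)) u≡1 ⟨
      2 * 2 ^ (n ∸ toℕ u)      ≡⟨ *-comm 2 (2 ^ (n ∸ toℕ u)) ⟩
      2 ^ (n ∸ toℕ u) * 2      ≤⟨ *-monoʳ-≤ (2 ^ (n ∸ toℕ u)) 2≤D ⟩
      2 ^ (n ∸ toℕ u) * D u    ≤⟨ Down.term≤weight D u ⟩
      Down.weight D            ∎)
      where open ≤-Reasoning
    avoid : CyclicAdj u w → toℕ w ≢ 0
    avoid (inj₁ (inj₁ w≡1+u)) w≡0 = 1+n≢0 (trans (sym w≡1+u) w≡0)
    avoid (inj₁ (inj₂ (1+u≡n , _))) _ = notUp 1+u≡n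
    avoid (inj₂ (inj₁ u≡1+w)) w≡0 = notDown (trans u≡1+w (cong suc w≡0))
    avoid (inj₂ (inj₂ (_ , u≡0))) _ = u≢0 u≡0
    w≢0 = avoid e
    wtUp : CyclicAdj u w → 2 ^ toℕ w ≤ 2 * 2 ^ toℕ u
    wtUp (inj₁ (inj₁ w≡1+u)) = ≤-reflexive (cong (2 ^_) w≡1+u)
    wtUp (inj₁ (inj₂ (_ , w≡0))) = ⊥-elim (w≢0 w≡0)
    wtUp (inj₂ (inj₁ u≡1+w)) = ^-monoʳ-≤ 2 (≤-trans (n≤1+n _) (≤-trans (≤-reflexive (sym u≡1+w)) (n≤1+n _)))
    wtUp (inj₂ (inj₂ (_ , u≡0))) = ⊥-elim (u≢0 u≡0)
    wtDown : CyclicAdj u w → 2 ^ (n ∸ toℕ w) ≤ 2 * 2 ^ (n ∸ toℕ u)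
    wtDown (inj₁ (inj₁ w≡1+u)) = ^-monoʳ-≤ 2 (≤-trans (∸-monoʳ-≤ n (≤-trans (n≤1+n _) (≤-reflexive (sym w≡1+u)))) (n≤1+n _))
    wtDown (inj₁ (inj₂ (_ , w≡0))) = ⊥-elim (w≢0 w≡0)
    wtDown (inj₂ (inj₁ u≡1+w)) = ≤-reflexive (trans (double-n∸ (toℕ<n w)) (cong (λ i → 2 * 2 ^ (n ∸ i)) (sym u≡1+w)))
    wtDown (inj₂ (inj₂ (_ , u≡0))) = ⊥-elim (u≢0 u≡0)

  light-unsolvable : ∀ {D} → Light D → ¬ CanPlace 1 origin D
  light-unsolvable (D0 , _) (_ , ε , 1≤) with subst (1 ≤_) D0 1≤
  ... | ()
  light-unsolvable light (D′ , s ◅ ss , 1≤) = light-unsolvable (light-⟶ s light) (D′ , ss , 1≤)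

  module _ (m b : ℕ) (n≡ : n ≡ suc (suc m + suc m)) (2^m : 2 ^ m ≡ 3 * b + 1) where

    private
      far₁< : suc m < n
      far₁< = subst (suc m <_) (sym n≡) (s≤s (m≤m+n (suc m) (suc m)))
      far₂< : suc (suc m) < n
      far₂< = subst (suc (suc m) <_) (sym n≡) (s≤s (s≤s (m≤n+m (suc m) m)))
      -- As n = 2m + 3, the vertices m + 1 and m + 2 are both at distance m + 1 from 0.
      far₁ = fromℕ< far₁<
      far₂ = fromℕ< far₂<
      antipodal : ℕ → ℕ → Distribution
      antipodal q₁ q₂ = q₁ • far₁ ⊕ q₂ • far₂

    -- At worst the left side is 6(4b + 1)(3b + 1), while the right side is 8(3b + 1)(3b + 1), and
    -- 24b + 6 < 24b + 8.
    few : ∀ q₁ q₂ → q₁ ≤ 4 * b + 1 → q₂ ≤ 4 * b + 1 →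
          q₁ * 2 ^ suc m + q₂ * 2 ^ suc (suc m) < 2 ^ n
    few q₁ q₂ p₁ p₂ = begin-strict
      q₁ * 2 ^ suc m + q₂ * 2 ^ suc (suc m)
        ≤⟨ +-mono-≤ (*-monoˡ-≤ (2 ^ suc m) p₁) (*-monoˡ-≤ (2 ^ suc (suc m)) p₂) ⟩
      (4 * b + 1) * (2 * 2 ^ m) + (4 * b + 1) * (2 * (2 * 2 ^ m))
        ≡⟨ cong (λ a → (4 * b + 1) * (2 * a) + (4 * b + 1) * (2 * (2 * a))) 2^m ⟩
      (4 * b + 1) * (2 * (3 * b + 1)) + (4 * b + 1) * (2 * (2 * (3 * b + 1)))
        <⟨ ≤-trans (m≤m+n _ (6 * b + 1)) (≤-reflexive (identity b)) ⟩
      2 * ((3 * b + 1) * (2 * (2 * (3 * b + 1))))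
        ≡⟨ cong (λ a → 2 * (a * (2 * (2 * a)))) 2^m ⟨
      2 * (2 ^ m * 2 ^ suc (suc m))
        ≡⟨ cong (2 *_) (^-distribˡ-+-* 2 m (suc (suc m))) ⟨
      2 ^ suc (m + suc (suc m))
        ≡⟨ cong (2 ^_) (trans n≡ (cong (suc) (sym (+-suc m (suc m))))) ⟨
      2 ^ n ∎
      where
      open ≤-Reasoning
      identity : ∀ b → suc ((4 * b + 1) * (2 * (3 * b + 1)) + (4 * b + 1) * (2 * (2 * (3 * b + 1)))) + (6 * b + 1) ≡
                       2 * ((3 * b + 1) * (2 * (2 * (3 * b + 1))))
      identity = solve-∀

    antipodal-light : ∀ q₁ q₂ → q₁ ≤ 4 * b + 1 → q₂ ≤ 4 * b + 1 → Light (antipodal q₁ q₂)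
    antipodal-light q₁ q₂ p₁ p₂ =
      cong₂ _+_ (off q₁ far₁ (far≢ far₁<)) (off q₂ far₂ (far≢ far₂<)) ,
      subst (_< 2 ^ n) (sym upEq) (few q₁ q₂ p₁ p₂) ,
      subst (_< 2 ^ n) (sym downEq) (few q₂ q₁ p₂ p₁)
      where
      far≢ : ∀ {i} (i< : suc i < n) → origin ≢ fromℕ< i<
      far≢ i< eq = 1+n≢0 (trans (sym (toℕ-fromℕ< i<)) (trans (cong toℕ (sym eq)) toℕ-origin))
      off : ∀ q u → origin ≢ u → (q • u) origin ≡ 0
      off q u ≢u with origin ≟ᵥ u
      ... | yes eq = ⊥-elim (≢u eq)
      ... | no  _  = *-zeroʳ q
      upEq : Up.weight (antipodal q₁ q₂) ≡ q₁ * 2 ^ suc m + q₂ * 2 ^ suc (suc m)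
      upEq = trans (Up.weight-⊕ (q₁ • far₁) (q₂ • far₂)) (cong₂ _+_
        (trans (Up.weight-• q₁ far₁) (cong (λ i → q₁ * 2 ^ i) (toℕ-fromℕ< far₁<)))
        (trans (Up.weight-• q₂ far₂) (cong (λ i → q₂ * 2 ^ i) (toℕ-fromℕ< far₂<))))
      n∸far₁ : n ∸ suc m ≡ suc (suc m)
      n∸far₁ = trans (cong (_∸ suc m) (trans n≡ (sym (+-suc (suc m) (suc m))))) (m+n∸m≡n (suc m) (suc (suc m)))
      n∸far₂ : n ∸ suc (suc m) ≡ suc m
      n∸far₂ = trans (cong (_∸ suc (suc m)) n≡) (m+n∸m≡n (suc (suc m)) (suc m))
      downEq : Down.weight (antipodal q₁ q₂) ≡ q₂ * 2 ^ suc m + q₁ * 2 ^ suc (suc m)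
      downEq = trans (Down.weight-⊕ (q₁ • far₁) (q₂ • far₂)) (trans (cong₂ _+_
        (trans (Down.weight-• q₁ far₁) (cong (λ i → q₁ * 2 ^ i) (trans (cong (n ∸_) (toℕ-fromℕ< far₁<)) n∸far₁)))
        (trans (Down.weight-• q₂ far₂) (cong (λ i → q₂ * 2 ^ i) (trans (cong (n ∸_) (toℕ-fromℕ< far₂<)) n∸far₂))))
        (+-comm (q₁ * 2 ^ suc (suc m)) (q₂ * 2 ^ suc m)))

    lower-bound : 8 * b + 3 ≤ f C
    lower-bound = ≮⇒≥ (λ f< → light-unsolvable
      -- `Suffices` fixes the number of pebbles, so exactly `f C` are distributed, at most 4b + 1 on
      -- either vertex.
      (antipodal-light (a ⊓ f C) (f C ∸ a) (m⊓n≤m a (f C)) (m≤n+o⇒m∸n≤o (f C) a (small f<)))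
      (proj₁ (f-isPebblingNumber C) (antipodal (a ⊓ f C) (f C ∸ a)) size≡ origin))
      where
      a = 4 * b + 1
      small : f C < 8 * b + 3 → f C ≤ a + a
      small f< = s≤s⁻¹ (≤-trans f< (≤-reflexive (identity b)))
        where
        identity : ∀ b → 8 * b + 3 ≡ suc (4 * b + 1 + (4 * b + 1))
        identity = solve-∀
      size-• : ∀ q u → size (q • u) ≡ q
      size-• q u = trans (sum-map-* q (δ u) vertices) (trans (cong (q *_) (size-δ u)) (*-identityʳ q))
      size≡ : size (antipodal (a ⊓ f C) (f C ∸ a)) ≡ f C
      size≡ = trans (size-⊕ ((a ⊓ f C) • far₁) ((f C ∸ a) • far₂))
        (trans (cong₂ _+_ (size-• (a ⊓ f C) far₁) (size-• (f C ∸ a) far₂)) (m⊓n+n∸m≡n a (f C)))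

-- Sums over ranges and products.

∑ : ℕ → (ℕ → ℕ) → ℕ
∑ zero    h = 0
∑ (suc n) h = ∑ n h + h n

∑-front : ∀ n h → ∑ (suc n) h ≡ h 0 + ∑ n (h ∘ suc)
∑-front zero    h = sym (+-identityʳ (h 0))
∑-front (suc n) h = trans (cong (_+ h (suc n)) (∑-front n h)) (+-assoc (h 0) _ _)

-- The second block is read from its end, since the walk `y` leaves the target backwards around the
-- cycle.
∑-split-reverse : ∀ a b h → ∑ (a + b) h ≡ ∑ a h + ∑ b (λ i → h (a + b ∸ suc i))
∑-split-reverse a zero    h = trans (cong (λ s → ∑ s h) (+-identityʳ a)) (sym (+-identityʳ _))
∑-split-reverse a (suc b) h = begin
  ∑ (a + suc b) h                                    ≡⟨ cong (λ s → ∑ s h) (+-suc a b) ⟩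
  ∑ (a + b) h + h (a + b)                            ≡⟨ cong (_+ h (a + b)) (∑-split-reverse a b h) ⟩
  ∑ a h + ∑ b (λ i → h (a + b ∸ suc i)) + h (a + b)  ≡⟨ swap (∑ a h) _ (h (a + b)) ⟩
  ∑ a h + (h (a + b) + ∑ b (λ i → h (a + b ∸ suc i)))
    ≡⟨ cong (λ s → ∑ a h + (h (s ∸ 1) + ∑ b (λ i → h (s ∸ suc (suc i))))) (+-suc a b) ⟨
  ∑ a h + (h (a + suc b ∸ 1) + ∑ b (λ i → h (a + suc b ∸ suc (suc i))))
    ≡⟨ cong (∑ a h +_) (∑-front b (λ i → h (a + suc b ∸ suc i))) ⟨
  ∑ a h + ∑ (suc b) (λ i → h (a + suc b ∸ suc i))    ∎
  where
  open ≡-Reasoning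
  swap : ∀ x y z → x + y + z ≡ x + (z + y)
  swap = solve-∀

term≤∑ : ∀ {n i} h → i < n → h i ≤ ∑ n h
term≤∑ {suc n} {i} h i< with m≤n⇒m<n∨m≡n (s≤s⁻¹ i<)
... | inj₁ i<n  = ≤-trans (term≤∑ h i<n) (m≤m+n _ _)
... | inj₂ refl = m≤n+m _ _

∑-single : ∀ n h j {B} → (∀ i → i < n → i ≢ j → h i ≡ 0) → h j ≤ B → ∑ n h ≤ B
∑-single zero    h j vanish hj≤ = z≤n
∑-single (suc n) h j {B} vanish hj≤ with n ≟ j
... | yes refl = +-mono-≤ (∑-zero n (λ i i<n → vanish i (m<n⇒m<1+n i<n) (<⇒≢ i<n))) hj≤
  where
  ∑-zero : ∀ n → (∀ i → i < n → h i ≡ 0) → ∑ n h ≤ 0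
  ∑-zero zero    z = z≤n
  ∑-zero (suc n) z = +-mono-≤ (∑-zero n (λ i i<n → z i (m<n⇒m<1+n i<n))) (≤-reflexive (z n ≤-refl))
... | no n≢j = subst (_≤ B) (sym (trans (cong (∑ n h +_) (vanish n ≤-refl n≢j)) (+-identityʳ _)))
                 (∑-single n h j (λ i i<n → vanish i (m<n⇒m<1+n i<n)) hj≤)

sum-cartesianProduct : ∀ {A B : Set} (h : A × B → ℕ) xs ys →
  sum (map h (cartesianProduct xs ys)) ≡ sum (map (λ x → sum (map (λ y → h (x , y)) ys)) xs)
sum-cartesianProduct h []       ys = refl
sum-cartesianProduct h (x ∷ xs) ys = begin
  sum (map h (map (x ,_) ys ++ cartesianProduct xs ys))
    ≡⟨ cong sum (map-++ h (map (x ,_) ys) _) ⟩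
  sum (map h (map (x ,_) ys) ++ map h (cartesianProduct xs ys))
    ≡⟨ sum-++ (map h (map (x ,_) ys)) _ ⟩
  sum (map h (map (x ,_) ys)) + sum (map h (cartesianProduct xs ys))
    ≡⟨ cong₂ _+_ (cong sum (sym (map-∘ ys))) (sum-cartesianProduct h xs ys) ⟩
  sum (map (λ y → h (x , y)) ys) + sum (map (λ x → sum (map (λ y → h (x , y)) ys)) xs) ∎
  where open ≡-Reasoning

-- Cutting the cycle open at the target.

module Rotation (n : ℕ) .{{_ : NonZero n}} (t : Fin n) where

  rotate : ℕ → Fin n
  rotate i = (toℕ t + i) mod n

  -- Subtraction of `t` modulo `n`, written as addition of `n ∸ toℕ t`; it inverts `rotate` below
  -- `n`.
  index : Fin n → ℕ
  index c = (toℕ c + (n ∸ toℕ t)) % n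

  private
    toℕ-mod : ∀ s → toℕ (s mod n) ≡ s % n
    toℕ-mod s = toℕ-fromℕ< _

    %-+ : ∀ a b → (a % n + b) % n ≡ (a + b) % n
    %-+ a b = trans (sym ([m+kn]%n≡m%n (a % n + b) (a / n) n))
      (cong (_% n) (trans (regroup (a % n) b (a / n * n)) (cong (_+ b) (sym (m≡m%n+[m/n]*n a n)))))
      where
      regroup : ∀ r b q → r + b + q ≡ r + q + b
      regroup = solve-∀

    around : ∀ i → i < n → (toℕ t + i + (n ∸ toℕ t)) % n ≡ i
    around i i<n = trans (cong (_% n) (trans (regroup (toℕ t) i (n ∸ toℕ t)) (cong (i +_) (m+[n∸m]≡n (<⇒≤ (toℕ<n t))))))
      (trans ([m+n]%n≡m%n i n) (m<n⇒m%n≡m i<n))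
      where
      regroup : ∀ t i d → t + i + d ≡ i + (t + d)
      regroup = solve-∀

  index< : ∀ c → index c < n
  index< c = m%n<n _ n

  index-rotate : ∀ i → i < n → index (rotate i) ≡ i
  index-rotate i i<n = trans (cong (λ s → (s + (n ∸ toℕ t)) % n) (toℕ-mod (toℕ t + i)))
    (trans (%-+ (toℕ t + i) (n ∸ toℕ t)) (around i i<n))

  rotate-index : ∀ c → rotate (index c) ≡ c
  rotate-index c = toℕ-injective (trans (toℕ-mod _)
    (trans (cong (_% n) (+-comm (toℕ t) _)) (trans (%-+ (toℕ c + (n ∸ toℕ t)) (toℕ t))
      (trans (cong (_% n) (regroup (toℕ c) (n ∸ toℕ t) (toℕ t))) (around (toℕ c) (toℕ<n c))))))
    where
    regroup : ∀ c d t → c + d + t ≡ t + c + d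
    regroup = solve-∀

  rotate-0 : rotate 0 ≡ t
  rotate-0 = toℕ-injective (trans (toℕ-mod _) (trans (cong (_% n) (+-identityʳ _)) (m<n⇒m%n≡m (toℕ<n t))))

  rotate-n : rotate n ≡ t
  rotate-n = toℕ-injective (trans (toℕ-mod _) (trans ([m+n]%n≡m%n (toℕ t) n) (m<n⇒m%n≡m (toℕ<n t))))

  rotate-suc : ∀ i → CyclicSuc (rotate i) (rotate (suc i))
  rotate-suc i = [ (λ <n → inj₁ (trans next (m<n⇒m%n≡m <n)))
                 , (λ ≡n → inj₂ (≡n , trans next (trans (cong (_% n) ≡n) (n%n≡0 n)))) ]′
                 (m≤n⇒m<n∨m≡n (toℕ<n (rotate i)))
    where
    next : toℕ (rotate (suc i)) ≡ suc (toℕ (rotate i)) % n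
    next = trans (toℕ-mod _) (trans (cong (_% n) (trans (+-suc (toℕ t) i) (+-comm 1 (toℕ t + i))))
      (trans (sym (%-+ (toℕ t + i) 1)) (cong (_% n) (trans (+-comm _ 1) (cong suc (sym (toℕ-mod (toℕ t + i))))))))

module Totals (C G : Graph) (odd₂ : OddTwoPebbling G) where
  open Pebbling G using (size)
  open Product C G odd₂
  private module □ = Reach (C □ G)

  size-place : ∀ c E → Pebbling.size (C □ G) (place c E) ≡ size E
  size-place c E = begin
    Pebbling.size (C □ G) (place c E)
      ≡⟨ sum-cartesianProduct (place c E) (Graph.vertices C) (Graph.vertices G) ⟩
    Pebbling.size C (λ c′ → size (λ g → place c E (c′ , g)))
      ≡⟨ Pebbling.sum-cong C row (Graph.vertices C) ⟩
    Pebbling.size C (λ c′ → size E * Pebbling.δ C c c′)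
      ≡⟨ sum-map-* (size E) (Pebbling.δ C c) (Graph.vertices C) ⟩
    size E * Pebbling.size C (Pebbling.δ C c)
      ≡⟨ cong (size E *_) (Reach.size-δ C c) ⟩
    size E * 1
      ≡⟨ *-identityʳ (size E) ⟩
    size E ∎
    where
    open ≡-Reasoning
    row : ∀ c′ → size (λ g → place c E (c′ , g)) ≡ size E * Pebbling.δ C c c′
    row c′ with Graph._≟ᵥ_ C c′ c
    ... | yes _ = sym (*-identityʳ (size E))
    ... | no  _ = trans (sum-map-* 0 (λ _ → 0) (Graph.vertices G)) (sym (*-zeroʳ (size E)))

  conf-∑ : ∀ w m p u → conf w m p u ≡ ∑ m (λ i → place (w i) (p i) u)
  conf-∑ w zero    p u = refl
  conf-∑ w (suc m) p u = cong (_+ place (w m) (p m) u) (conf-∑ w m p u)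

  total-∑ : ∀ m p → total m p ≡ ∑ m (λ i → size (p i))
  total-∑ zero    p = refl
  total-∑ (suc m) p = cong (_+ size (p m)) (total-∑ m p)

  size-conf : ∀ w m p → Pebbling.size (C □ G) (conf w m p) ≡ total m p
  size-conf w zero    p = sum-map-* 0 (λ _ → 0) (Graph.vertices (C □ G))
  size-conf w (suc m) p = trans (□.size-⊕ (conf w m p) (place (w m) (p m)))
                                (cong₂ _+_ (size-conf w m p) (size-place (w m) (p m)))

module Unroll (n : ℕ) (3≤n : 3 ≤ n) (m : ℕ) (n≡ : n ≡ suc (suc m + suc m))
              (G : Graph) (odd₂ : OddTwoPebbling G) (t : Fin n)
              (D : Pebbling.Distribution (cycle n 3≤n □ G)) where
  private
    C = cycle n 3≤n
    instance
      n≢0 : NonZero n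
      n≢0 = >-nonZero (≤-trans (s≤s z≤n) 3≤n)
    M = suc m + suc m
  open Graph C using (_~_)
  open Rotation n t public
  open Pebbling G using (Distribution; size)
  open Reach G using (lo; hi; lo+hi)
  open OddCopies G odd₂ using (N)
  open Product C G odd₂
  open Totals C G odd₂
  open Reach (C □ G) using (_⇒_; weaken; _≼_)

  slice : ℕ → Distribution
  slice i g = D (rotate i , g)

  x y : ℕ → Fin n
  x i = rotate (suc i)
  -- Here `M` is n - 1, so the argument is n - 1 - i for i < M; this form matches the summand of
  -- `∑-split-reverse`.
  y i = rotate (suc (M ∸ suc i))

  p q : ℕ → Distribution
  p i = slice (suc i)
  q i = slice (suc (M ∸ suc i))

  ∑-unroll : ∀ h → ∑ n h ≡ h 0 + (∑ (suc m) (λ i → h (suc i)) + ∑ (suc m) (λ i → h (suc (M ∸ suc i))))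
  ∑-unroll h = trans (cong (λ s → ∑ s h) n≡)
    (trans (∑-front M h) (cong (h 0 +_) (∑-split-reverse (suc m) (suc m) (λ i → h (suc i)))))

  -- Only the summand at `index c` can be nonzero. This inequality serves the reachability statement
  -- `start`, the converse one the count `size≤`.
  slices≼D : conf rotate n slice ≼ D
  slices≼D (c , g) = subst (_≤ D (c , g)) (sym (conf-∑ rotate n slice (c , g)))
    (∑-single n (λ i → place (rotate i) (slice i) (c , g)) (index c) elsewhere here)
    where
    elsewhere : ∀ i → i < n → i ≢ index c → place (rotate i) (slice i) (c , g) ≡ 0
    elsewhere i i<n i≢ with c Finₚ.≟ rotate i
    ... | yes c≡ = ⊥-elim (i≢ (trans (sym (index-rotate i i<n)) (cong index (sym c≡))))
    ... | no  _  = refl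
    here : place (rotate (index c)) (slice (index c)) (c , g) ≤ D (c , g)
    here with c Finₚ.≟ rotate (index c)
    ... | yes _ = ≤-reflexive (cong (λ c′ → D (c′ , g)) (rotate-index c))
    ... | no  _ = z≤n

  D≼slices : D ≼ conf rotate n slice
  D≼slices (c , g) = begin
    D (c , g)                                                 ≡⟨ at (rotate (index c)) (rotate-index c) ⟨
    place (rotate (index c)) (slice (index c)) (c , g)        ≤⟨ term≤∑ (λ i → place (rotate i) (slice i) (c , g)) (index< c) ⟩
    ∑ n (λ i → place (rotate i) (slice i) (c , g))            ≡⟨ conf-∑ rotate n slice (c , g) ⟨
    conf rotate n slice (c , g)                               ∎
    where
    open ≤-Reasoning
    at : ∀ c′ → c′ ≡ c → place c′ (λ g′ → D (c′ , g′)) (c , g) ≡ D (c , g)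
    at c′ refl = place-self c (λ g′ → D (c , g′)) g

  start : (v : Graph.Vertex G) → D ⇒ TwoWalks.Start C G odd₂ v (rotate 0) (slice 0) m x y p q
  start v = weaken (λ u → subst (_≤ D u)
    (trans (conf-∑ rotate n slice u) (trans (∑-unroll (λ i → place (rotate i) (slice i) u))
      (cong (place (rotate 0) (slice 0) u +_)
        (sym (cong₂ _+_ (conf-∑ x (suc m) p u) (conf-∑ y (suc m) q u))))))
    (slices≼D u))

  size≤ : Pebbling.size (C □ G) D ≤ size (slice 0) + (total m p + (lo (p m) + hi (p m)) +
                                                     (total m q + (lo (q m) + hi (q m))))
  size≤ = begin
    Pebbling.size (C □ G) D                           ≤⟨ sum-map-≤ D≼slices (Graph.vertices (C □ G)) ⟩
    Pebbling.size (C □ G) (conf rotate n slice)       ≡⟨ size-conf rotate n slice ⟩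
    total n slice                                     ≡⟨ total-∑ n slice ⟩
    ∑ n (λ i → size (slice i))                        ≡⟨ ∑-unroll (λ i → size (slice i)) ⟩
    size (slice 0) + (∑ (suc m) (λ i → size (p i)) + ∑ (suc m) (λ i → size (q i)))
      ≡⟨ cong (size (slice 0) +_) (cong₂ _+_ (total-∑ (suc m) p) (total-∑ (suc m) q)) ⟨
    size (slice 0) + (total (suc m) p + total (suc m) q)
      ≡⟨ cong (size (slice 0) +_) (cong₂ _+_ (cong (total m p +_) (lo+hi (p m))) (cong (total m q +_) (lo+hi (q m)))) ⟨
    _ ∎
    where open ≤-Reasoning

  t~x : rotate 0 ~ x 0
  t~x = inj₁ (rotate-suc 0)

  t~y : rotate 0 ~ y 0
  t~y = inj₂ (subst (CyclicSuc (y 0)) (trans (cong rotate (sym n≡)) (trans rotate-n (sym rotate-0))) (rotate-suc M))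

  walkˣ : Walk x m
  walkˣ i _ = inj₁ (rotate-suc (suc i))

  walkʸ : Walk y m
  walkʸ i i<m = inj₂ (subst (CyclicSuc (y (suc i))) (cong (λ s → rotate (suc s)) back)
                            (rotate-suc (suc (M ∸ suc (suc i)))))
    where
    back : suc (M ∸ suc (suc i)) ≡ M ∸ suc i
    back = sym (+-∸-assoc 1 {M} {suc (suc i)} (s≤s (≤-trans i<m (m≤m+n m (suc m)))))

  antipodal : x m ~ y m
  antipodal = inj₁ (subst (λ s → CyclicSuc (x m) (rotate (suc s))) (sym (m+n∸n≡m (suc m) (suc m))) (rotate-suc (suc m)))

-- Powers of four and the conclusion.

-- This is (4 ^ k - 1) / 3, the `b` of the case analysis. The recursion avoids division and exhibits
-- it as a successor for k > 0.
third : ℕ → ℕ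
third zero    = 0
third (suc k) = suc (4 * third k)

4^k : ∀ k → 2 ^ (2 * k) ≡ 3 * third k + 1
4^k zero    = refl
4^k (suc k) = begin
  2 ^ (2 * suc k)                ≡⟨ cong (2 ^_) (*-suc 2 k) ⟩
  2 * (2 * 2 ^ (2 * k))          ≡⟨ cong (λ a → 2 * (2 * a)) (4^k k) ⟩
  2 * (2 * (3 * third k + 1))    ≡⟨ identity (third k) ⟩
  3 * suc (4 * third k) + 1      ∎
  where
  open ≡-Reasoning
  identity : ∀ b → 2 * (2 * (3 * b + 1)) ≡ 3 * suc (4 * b) + 1
  identity = solve-∀

cycle-length : ∀ k → 4 * k + 3 ≡ suc (suc (2 * k) + suc (2 * k))
cycle-length = solve-∀

theorem2p3 : (k : ℕ) (G : Graph) → OddTwoPebbling G →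
    let C = cycle (4 * k + 3) (m≤n+m 3 (4 * k)) in
    f (C □ G) ≤ f C * f G
theorem2p3 k G odd₂ = proj₂ (f-isPebblingNumber (C □ G)) (f C * f G) suffices
  where
  C = cycle (4 * k + 3) (m≤n+m 3 (4 * k))
  open Reach (C □ G) using (_⇒_; reach; _⨾_)
  open Product C G odd₂ using (place; place-self; Walk)
  open Graph C using (_~_)

  module _ (D : Pebbling.Distribution (C □ G)) (sizeD : Pebbling.size (C □ G) D ≡ f C * f G)
           (t : Graph.Vertex C) (v : Graph.Vertex G) where
    open Unroll (4 * k + 3) (m≤n+m 3 (4 * k)) (2 * k) (cycle-length k) G odd₂ t D
    open TwoWalks C G odd₂ v (rotate 0) (slice 0)

    enough : Enough (third k) (2 * k) p q
    enough = ≤-trans (*-monoˡ-≤ (f G)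
      (CycleLowerBound.lower-bound (4 * k + 3) (m≤n+m 3 (4 * k)) (2 * k) (third k) (cycle-length k) (4^k k)))
      (≤-trans (≤-reflexive (sym sizeD)) size≤)

    -- The walks and their length are generalised, so that the split on `k` leaves the ambient cycle
    -- alone.
    solve : ∀ k x y p q → Walk x (2 * k) → Walk y (2 * k) → rotate 0 ~ x 0 → rotate 0 ~ y 0 → x (2 * k) ~ y (2 * k) →
            Enough (third k) (2 * k) p q → Start (2 * k) x y p q ⇒ place (rotate 0) (Reach._•_ G 1 v)
    solve zero    x y p q _     _     = solve-triangle x y p q
    -- The witness `k + suc (k + 0)` is the predecessor of `2 * suc k`, as that product reduces.
    solve (suc k) x y p q walkˣ walkʸ = solve-long (k + suc (k + 0)) (4 * third k) (4^k (suc k)) x y p q walkˣ walkʸ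

    placed : Pebbling.CanPlace (C □ G) 1 (t , v) D
    placed = finish (start v ⨾ solve k x y p q walkˣ walkʸ t~x t~y antipodal enough)
      where
      finish : D ⇒ place (rotate 0) (Reach._•_ G 1 v) → Pebbling.CanPlace (C □ G) 1 (t , v) D
      finish (reach {E} ss bound) = E , ss ,
        subst (λ c → 1 ≤ E (c , v)) rotate-0
          (subst (_≤ E (rotate 0 , v)) (trans (place-self (rotate 0) (Reach._•_ G 1 v) v) (cong (1 *_) (Reach.δ-self G v)))
            (bound (rotate 0 , v)))

  suffices : Pebbling.Suffices (C □ G) (f C * f G)
  suffices D sizeD (t , v) = placed D sizeD t v
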